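{- For every special $\Pi^0_1$ set $P\subseteq2^{\mathbb N}$, there exists a $\Pi^0_1$ set $Q\subseteq2^{\mathbb N}$ such that $Q<^1_1P$ and $Q\equiv^1_{<\omega}P$.
   Context: A set is special if it is nonempty and contains no computable element. Let $\{\Phi_e\}_{e\in\mathbb N}$ be an effective enumeration of all partial computable functions $\Phi_e:\subseteq\mathbb N^{\mathbb N}\to\mathbb N^{\mathbb N}$. A learner is a total computable function $\Psi:\mathbb N^{<\mathbb N}\to\mathbb N$. A partial function $\Gamma:\subseteq\mathbb N^{\mathbb N}\to\mathbb N^{\mathbb N}$ is $(1,1)$-computable if it is computable. It is $(1,<\omega)$-computable if there is a learner $\Psi$ such that for every $g\in\mathrm{dom}(\Gamma)$ the limit $\lim_n\Psi(g\upharpoonright n)$ exists and $\Phi_{\lim_n\Psi(g\upharpoonright n)}(g)=\Gamma(g)$, and $\sup_{g\in\mathrm{dom}(\Gamma)}\#\{n:\Psi(g\upharpoonright(n+1))\neq\Psi(g\upharpoonright n)\}<\omega$. For $A,B\subseteq\mathbb N^{\mathbb N}$, $A\le^\alpha_\beta B$ means there is an $(\alpha,\beta)$-computable partial function $\Gamma$ with $B\subseteq\mathrm{dom}(\Gamma)$ and $\Gamma(g)\in A$ for every $g\in B$. $A<^\alpha_\beta B$ means $A\le^\alpha_\beta B$ and $B\not\le^\alpha_\beta A$; $A\equiv^\alpha_\beta B$ means both reductions hold. -}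

module Defs where

open import Data.Bool using (Bool; T; if_then_else_)
open import Data.Empty using (⊥)
open import Data.List using (List; []; _∷_; length; applyUpTo)
open import Data.List.Membership.Propositional using () renaming (_∈_ to _∈ˡ_)
open import Data.Nat using (ℕ; zero; suc; _+_; _≤_; _<_; z≤n; s≤s; s≤s⁻¹)
open import Data.Nat.Properties
  using (+-identityʳ; +-suc; +-comm; ≤-refl; ≤-trans; m≤m+n; m≤n+m; <-cmp)
open import Data.Product using (Σ; ∃; ∃-syntax; _×_; _,_; proj₁; proj₂)
open import Data.Unit using (⊤; tt)
open import Function.Bundles using (_⇔_)
open import Level using (0ℓ)
open import Relation.Binary.Definitions using (tri<; tri≈; tri>)
open import Relation.Binary.PropositionalEquality
  using (_≡_; _≢_; _≗_; refl; sym; trans; cong; cong₂; subst)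
open import Relation.Nullary using (¬_)
open import Relation.Unary using (Pred; _∈_)

triangle : ℕ → ℕ
triangle zero    = 0
triangle (suc n) = suc (n + triangle n)

⟪_,_⟫ : ℕ → ℕ → ℕ
⟪ a , b ⟫ = triangle (a + b) + a

-- The successor of a pair in Cantor's walk along the antidiagonals.
next : ℕ × ℕ → ℕ × ℕ
next (a , zero)  = 0 , suc a
next (a , suc b) = suc a , b

unpair : ℕ → ℕ × ℕ
unpair zero    = 0 , 0
unpair (suc n) = next (unpair n)

left right : ℕ → ℕ
left n  = proj₁ (unpair n)
right n = proj₂ (unpair n)

unpair-diagonal : ∀ s a b → a + b ≡ s → unpair (triangle s + a) ≡ (a , b)
unpair-diagonal zero    zero    zero    refl = refl
unpair-diagonal (suc s) zero    .(suc s) refl =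
  trans (cong unpair (+-identityʳ (suc (s + triangle s))))
  (trans (cong (λ m → next (unpair m)) (+-comm s (triangle s)))
         (cong next (unpair-diagonal s s 0 (+-identityʳ s))))
unpair-diagonal (suc s) (suc a) b eq =
  trans (cong unpair (+-suc (triangle (suc s)) a))
        (cong next (unpair-diagonal (suc s) a (suc b) (trans (+-suc a b) eq)))

unpair-pair : ∀ a b → unpair ⟪ a , b ⟫ ≡ (a , b)
unpair-pair a b = unpair-diagonal (a + b) a b refl

⌜_⌝ : List ℕ → ℕ
⌜ [] ⌝    = 0
⌜ a ∷ σ ⌝ = suc ⟪ a , ⌜ σ ⌝ ⟫

-- Codes denote unary partial functions; several arguments are passed as
-- a pair.  Code ⊥ has no oracle, Code ⊤ has one.
data Code (O : Set) : Set where
  zeroᶜ succᶜ leftᶜ rightᶜ : Code O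
  oracleᶜ                  : O → Code O
  pairᶜ compᶜ precᶜ        : Code O → Code O → Code O
  μᶜ                       : Code O → Code O

infix 4 _⊢_[_]⇓_

-- g ⊢ c [ n ]⇓ y : with oracles g, the computation c halts on n with
-- output y.
data _⊢_[_]⇓_ {O : Set} (g : O → ℕ → ℕ) : Code O → ℕ → ℕ → Set where
  zero⇓     : ∀ {n} → g ⊢ zeroᶜ [ n ]⇓ 0
  succ⇓     : ∀ {n} → g ⊢ succᶜ [ n ]⇓ suc n
  left⇓     : ∀ {n} → g ⊢ leftᶜ [ n ]⇓ left n
  right⇓    : ∀ {n} → g ⊢ rightᶜ [ n ]⇓ right n
  oracle⇓   : ∀ {o n} → g ⊢ oracleᶜ o [ n ]⇓ g o n
  pair⇓     : ∀ {c d n a b} → g ⊢ c [ n ]⇓ a → g ⊢ d [ n ]⇓ b →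
              g ⊢ pairᶜ c d [ n ]⇓ ⟪ a , b ⟫
  comp⇓     : ∀ {c d n m y} → g ⊢ d [ n ]⇓ m → g ⊢ c [ m ]⇓ y →
              g ⊢ compᶜ c d [ n ]⇓ y
  prec-zero⇓ : ∀ {c d n y} → right n ≡ 0 → g ⊢ c [ left n ]⇓ y →
              g ⊢ precᶜ c d [ n ]⇓ y
  prec-suc⇓ : ∀ {c d n m v y} → right n ≡ suc m →
              g ⊢ precᶜ c d [ ⟪ left n , m ⟫ ]⇓ v →
              g ⊢ d [ ⟪ left n , ⟪ m , v ⟫ ⟫ ]⇓ y →
              g ⊢ precᶜ c d [ n ]⇓ y
  -- The values below the least zero are w z + 1, so they are defined and
  -- nonzero.
  μ⇓        : ∀ {c n y} (w : ℕ → ℕ) →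
              (∀ z → z < y → g ⊢ c [ ⟪ n , z ⟫ ]⇓ suc (w z)) →
              g ⊢ c [ ⟪ n , y ⟫ ]⇓ 0 →
              g ⊢ μᶜ c [ n ]⇓ y

private
  0≢suc : ∀ {n} {A : Set} → 0 ≡ suc n → A
  0≢suc ()

  suc-inj : ∀ {m n} → suc m ≡ suc n → m ≡ n
  suc-inj refl = refl

⇓-deterministic : ∀ {O g} {c : Code O} {n y y′} →
                  g ⊢ c [ n ]⇓ y → g ⊢ c [ n ]⇓ y′ → y ≡ y′
⇓-deterministic zero⇓ zero⇓ = refl
⇓-deterministic succ⇓ succ⇓ = refl
⇓-deterministic left⇓ left⇓ = refl
⇓-deterministic right⇓ right⇓ = refl
⇓-deterministic oracle⇓ oracle⇓ = refl
⇓-deterministic (pair⇓ p q) (pair⇓ p′ q′) =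
  cong₂ ⟪_,_⟫ (⇓-deterministic p p′) (⇓-deterministic q q′)
⇓-deterministic (comp⇓ p q) (comp⇓ p′ q′) with refl ← ⇓-deterministic p p′ =
  ⇓-deterministic q q′
⇓-deterministic (prec-zero⇓ _ p) (prec-zero⇓ _ p′) = ⇓-deterministic p p′
⇓-deterministic (prec-zero⇓ e _) (prec-suc⇓ e′ _ _) = 0≢suc (trans (sym e) e′)
⇓-deterministic (prec-suc⇓ e _ _) (prec-zero⇓ e′ _) = 0≢suc (trans (sym e′) e)
⇓-deterministic (prec-suc⇓ e p q) (prec-suc⇓ e′ p′ q′)
  with refl ← suc-inj (trans (sym e) e′)
  with refl ← ⇓-deterministic p p′ = ⇓-deterministic q q′
⇓-deterministic {y = y} {y′} (μ⇓ w h p) (μ⇓ w′ h′ p′) with <-cmp y y′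
... | tri< y<y′ _ _ = 0≢suc (⇓-deterministic p (h′ y y<y′))
... | tri≈ _ eq _   = eq
... | tri> _ _ y′<y = 0≢suc (sym (⇓-deterministic (h y′ y′<y) p′))

⇓-resp-≗ : ∀ {O} {g g′ : O → ℕ → ℕ} {c : Code O} {n y} →
           (∀ o → g o ≗ g′ o) → g ⊢ c [ n ]⇓ y → g′ ⊢ c [ n ]⇓ y
⇓-resp-≗ g≗g′ zero⇓ = zero⇓
⇓-resp-≗ g≗g′ succ⇓ = succ⇓
⇓-resp-≗ g≗g′ left⇓ = left⇓
⇓-resp-≗ g≗g′ right⇓ = right⇓
⇓-resp-≗ {g′ = g′} g≗g′ (oracle⇓ {o} {n}) =
  subst (g′ ⊢ oracleᶜ o [ n ]⇓_) (sym (g≗g′ o n)) oracle⇓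
⇓-resp-≗ g≗g′ (pair⇓ p q) = pair⇓ (⇓-resp-≗ g≗g′ p) (⇓-resp-≗ g≗g′ q)
⇓-resp-≗ g≗g′ (comp⇓ p q) = comp⇓ (⇓-resp-≗ g≗g′ p) (⇓-resp-≗ g≗g′ q)
⇓-resp-≗ g≗g′ (prec-zero⇓ e p) = prec-zero⇓ e (⇓-resp-≗ g≗g′ p)
⇓-resp-≗ g≗g′ (prec-suc⇓ e p q) =
  prec-suc⇓ e (⇓-resp-≗ g≗g′ p) (⇓-resp-≗ g≗g′ q)
⇓-resp-≗ g≗g′ (μ⇓ w h p) =
  μ⇓ w (λ z z<y → ⇓-resp-≗ g≗g′ (h z z<y)) (⇓-resp-≗ g≗g′ p)

encode : Code ⊤ → ℕ
encode zeroᶜ        = ⟪ 0 , 0 ⟫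
encode succᶜ        = ⟪ 1 , 0 ⟫
encode leftᶜ        = ⟪ 2 , 0 ⟫
encode rightᶜ       = ⟪ 3 , 0 ⟫
encode (oracleᶜ tt) = ⟪ 4 , 0 ⟫
encode (pairᶜ c d)  = ⟪ 5 , ⟪ encode c , encode d ⟫ ⟫
encode (compᶜ c d)  = ⟪ 6 , ⟪ encode c , encode d ⟫ ⟫
encode (precᶜ c d)  = ⟪ 7 , ⟪ encode c , encode d ⟫ ⟫
encode (μᶜ c)       = ⟪ 8 , encode c ⟫

-- The first argument bounds the recursion depth; decode-encode below shows
-- that the bound used in decode is large enough, so every code has an index.
decodeWithin : ℕ → ℕ → Code ⊤
decodeNode   : ℕ → ℕ × ℕ → Code ⊤

decodeWithin zero    n = zeroᶜ
decodeWithin (suc k) n = decodeNode k (unpair n)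

decodeNode k (0 , _) = zeroᶜ
decodeNode k (1 , _) = succᶜ
decodeNode k (2 , _) = leftᶜ
decodeNode k (3 , _) = rightᶜ
decodeNode k (4 , _) = oracleᶜ tt
decodeNode k (5 , p) = pairᶜ (decodeWithin k (left p)) (decodeWithin k (right p))
decodeNode k (6 , p) = compᶜ (decodeWithin k (left p)) (decodeWithin k (right p))
decodeNode k (7 , p) = precᶜ (decodeWithin k (left p)) (decodeWithin k (right p))
decodeNode k (_ , p) = μᶜ (decodeWithin k p)

decode : ℕ → Code ⊤
decode n = decodeWithin (suc n) n

private
  n≤triangle : ∀ n → n ≤ triangle n
  n≤triangle zero    = z≤n
  n≤triangle (suc n) = s≤s (m≤m+n n (triangle n))

  a≤pair : ∀ a b → a ≤ ⟪ a , b ⟫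
  a≤pair a b = m≤n+m a (triangle (a + b))

  b≤pair : ∀ a b → b ≤ ⟪ a , b ⟫
  b≤pair a b = ≤-trans (m≤n+m b a) (≤-trans (n≤triangle (a + b)) (m≤m+n _ a))

  b<pair : ∀ t b → b < ⟪ suc t , b ⟫
  b<pair t b =
    ≤-trans (s≤s (m≤n+m b t)) (≤-trans (n≤triangle (suc t + b)) (m≤m+n _ (suc t)))

  fuelˡ : ∀ t {a b k} → ⟪ suc t , ⟪ a , b ⟫ ⟫ < suc k → a < k
  fuelˡ t {a} {b} lt = ≤-trans (s≤s (a≤pair a b)) (≤-trans (b<pair t _) (s≤s⁻¹ lt))

  fuelʳ : ∀ t {a b k} → ⟪ suc t , ⟪ a , b ⟫ ⟫ < suc k → b < k
  fuelʳ t {a} {b} lt = ≤-trans (s≤s (b≤pair a b)) (≤-trans (b<pair t _) (s≤s⁻¹ lt))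

  decodeWithin-encode : ∀ k c → encode c < k → decodeWithin k (encode c) ≡ c
  decodeWithin-encode (suc k) zeroᶜ        lt = refl
  decodeWithin-encode (suc k) succᶜ        lt = refl
  decodeWithin-encode (suc k) leftᶜ        lt = refl
  decodeWithin-encode (suc k) rightᶜ       lt = refl
  decodeWithin-encode (suc k) (oracleᶜ tt) lt = refl
  decodeWithin-encode (suc k) (pairᶜ c d)  lt =
    trans (cong (decodeNode k) (unpair-pair 5 ⟪ encode c , encode d ⟫))
      (cong₂ pairᶜ
        (trans (cong (λ u → decodeWithin k (proj₁ u)) (unpair-pair (encode c) (encode d)))
               (decodeWithin-encode k c (fuelˡ 4 {encode c} {encode d} lt)))
        (trans (cong (λ u → decodeWithin k (proj₂ u)) (unpair-pair (encode c) (encode d)))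
               (decodeWithin-encode k d (fuelʳ 4 {encode c} {encode d} lt))))
  decodeWithin-encode (suc k) (compᶜ c d)  lt =
    trans (cong (decodeNode k) (unpair-pair 6 ⟪ encode c , encode d ⟫))
      (cong₂ compᶜ
        (trans (cong (λ u → decodeWithin k (proj₁ u)) (unpair-pair (encode c) (encode d)))
               (decodeWithin-encode k c (fuelˡ 5 {encode c} {encode d} lt)))
        (trans (cong (λ u → decodeWithin k (proj₂ u)) (unpair-pair (encode c) (encode d)))
               (decodeWithin-encode k d (fuelʳ 5 {encode c} {encode d} lt))))
  decodeWithin-encode (suc k) (precᶜ c d)  lt =
    trans (cong (decodeNode k) (unpair-pair 7 ⟪ encode c , encode d ⟫))
      (cong₂ precᶜ
        (trans (cong (λ u → decodeWithin k (proj₁ u)) (unpair-pair (encode c) (encode d)))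
               (decodeWithin-encode k c (fuelˡ 6 {encode c} {encode d} lt)))
        (trans (cong (λ u → decodeWithin k (proj₂ u)) (unpair-pair (encode c) (encode d)))
               (decodeWithin-encode k d (fuelʳ 6 {encode c} {encode d} lt))))
  decodeWithin-encode (suc k) (μᶜ c)       lt =
    trans (cong (decodeNode k) (unpair-pair 8 (encode c)))
      (cong μᶜ (decodeWithin-encode k c (≤-trans (b<pair 7 (encode c)) (s≤s⁻¹ lt))))

decode-encode : ∀ c → decode (encode c) ≡ c
decode-encode c = decodeWithin-encode (suc (encode c)) c ≤-refl

noOracle : ⊥ → ℕ → ℕ
noOracle ()

Computable : (ℕ → ℕ) → Set
Computable f = Σ (Code ⊥) λ c → ∀ n → noOracle ⊢ c [ n ]⇓ f n

ComputableOnStrings : (List ℕ → ℕ) → Set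
ComputableOnStrings Ψ = Σ (Code ⊥) λ c → ∀ σ → noOracle ⊢ c [ ⌜ σ ⌝ ]⇓ Ψ σ

ComputableRelation : (List ℕ → Bool) → Set
ComputableRelation R = ComputableOnStrings (λ σ → if R σ then 1 else 0)

Baire : Set
Baire = ℕ → ℕ

_↾_ : Baire → ℕ → List ℕ
g ↾ n = applyUpTo g n

Cantor : Pred Baire 0ℓ
Cantor x = ∀ n → x n < 2

Π⁰₁ : Pred Baire 0ℓ → Set
Π⁰₁ P = Σ (List ℕ → Bool) λ R → ComputableRelation R ×
        (∀ x → x ∈ P ⇔ (∀ n → T (R (x ↾ n))))

Special : Pred Baire 0ℓ → Set
Special P = (∃ λ x → x ∈ P) × (∀ x → x ∈ P → ¬ Computable x)

-- Points of Baire space are compared pointwise, for lack of function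
-- extensionality.
record PartialFunction : Set₁ where
  field
    dom         : Pred Baire 0ℓ
    apply       : ∀ g → g ∈ dom → Baire
    dom-resp-≗  : ∀ {g g′} → g ≗ g′ → g ∈ dom → g′ ∈ dom
    apply-cong  : ∀ {g g′} (d : g ∈ dom) (d′ : g′ ∈ dom) →
                  g ≗ g′ → apply g d ≗ apply g′ d′

open PartialFunction public

infix 4 _≃_

_≃_ : PartialFunction → PartialFunction → Set
Γ ≃ Δ = (∀ g → g ∈ dom Γ ⇔ g ∈ dom Δ) ×
        (∀ g (d : g ∈ dom Γ) (d′ : g ∈ dom Δ) → apply Γ g d ≗ apply Δ g d′)

Φ : ℕ → PartialFunction
Φ e = record
  { dom        = λ g → ∀ n → ∃[ y ] (λ _ → g) ⊢ decode e [ n ]⇓ y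
  ; apply      = λ g d n → proj₁ (d n)
  ; dom-resp-≗ = λ g≗g′ d n → proj₁ (d n) , ⇓-resp-≗ (λ _ → g≗g′) (proj₂ (d n))
  ; apply-cong = λ d d′ g≗g′ n →
      ⇓-deterministic (⇓-resp-≗ (λ _ → g≗g′) (proj₂ (d n))) (proj₂ (d′ n))
  }

IsComputable : PartialFunction → Set
IsComputable Γ = ∃[ e ] Γ ≃ Φ e

Limit : (ℕ → ℕ) → ℕ → Set
Limit s e = ∃[ N ] (∀ n → N ≤ n → s n ≡ e)

HasAtMost : ℕ → Pred ℕ 0ℓ → Set
HasAtMost k S = Σ (List ℕ) λ xs → length xs ≤ k × (∀ n → n ∈ S → n ∈ˡ xs)

MindChange : (List ℕ → ℕ) → Baire → Pred ℕ 0ℓ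
MindChange Ψ g n = Ψ (g ↾ suc n) ≢ Ψ (g ↾ n)

IsLearnableWithBoundedMindChanges : PartialFunction → Set
IsLearnableWithBoundedMindChanges Γ =
  Σ (List ℕ → ℕ) λ Ψ → ComputableOnStrings Ψ ×
  (∀ g (d : g ∈ dom Γ) →
     ∃[ e ] Limit (λ n → Ψ (g ↾ n)) e ×
            Σ (g ∈ dom (Φ e)) λ d′ → apply (Φ e) g d′ ≗ apply Γ g d) ×
  (∃[ k ] (∀ g → g ∈ dom Γ → HasAtMost k (MindChange Ψ g)))

ReducibleVia : (PartialFunction → Set) → Pred Baire 0ℓ → Pred Baire 0ℓ → Set₁
ReducibleVia 𝒞 A B =
  Σ PartialFunction λ Γ → 𝒞 Γ ×
  Σ (∀ g → g ∈ B → g ∈ dom Γ) λ B⊆dom → ∀ g (b : g ∈ B) → apply Γ g (B⊆dom g b) ∈ A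

infix 4 _≤¹₁_ _<¹₁_ _≤¹<ω_ _≡¹<ω_

_≤¹₁_ _<¹₁_ _≤¹<ω_ _≡¹<ω_ : Pred Baire 0ℓ → Pred Baire 0ℓ → Set₁
A ≤¹₁ B  = ReducibleVia IsComputable A B
A <¹₁ B  = A ≤¹₁ B × ¬ (B ≤¹₁ A)
A ≤¹<ω B = ReducibleVia IsLearnableWithBoundedMindChanges A B
A ≡¹<ω B = A ≤¹<ω B × B ≤¹<ω A

{-# OPTIONS --safe #-}
module Submission where

-- Call x ↾ k a leaf of x when the relation R defining P first fails there, and
-- let Q consist of the binary x such that either x ∈ P, or x has a leaf and
-- what follows the leaf is in P.  The identity reduces Q to P.  Conversely, a
-- learner copies its input until it sees a leaf, and then changes its mind
-- once, copying only what follows the leaf.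
--
-- Suppose that a code c reduces P to Q.  For each leaf ρ, the map
-- F_ρ y = c (ρ ⌢ y) sends P to P.  Since P has no computable element, the
-- prefixes of an x₀ ∈ P can be continued to leaves.  Hence, given leaves
-- ρ₀, …, ρ_{k-1}, a search finds a leaf ρ_k such that
-- F_{ρ₀} (… (F_{ρ_k} y)) k is already determined without any knowledge of y.
-- These values form a computable z.  Every prefix z ↾ n is a prefix of
-- F_{ρ₀} (… (F_{ρ_{n-1}} x₀)), which is in P, so z ∈ P: a contradiction.

open import Defs
open import Axiom.ExcludedMiddle using (ExcludedMiddle)
open import Data.Bool using (Bool; true; T; if_then_else_)
open import Data.Empty using (⊥; ⊥-elim)
open import Data.List using (List; []; _∷_; length; applyUpTo)
open import Data.List.Properties using (length-applyUpTo)
open import Data.List.Relation.Unary.Any using (here)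
open import Data.Nat using (ℕ; zero; suc; pred; _+_; _∸_; _≤_; _<_; z≤n; s≤s; s≤s⁻¹; _⊔_; _≡ᵇ_)
open import Data.Nat.Properties
open import Data.Product using (Σ; ∃; ∃-syntax; _×_; _,_; proj₁; proj₂)
open import Data.Sum using (_⊎_; inj₁; inj₂)
open import Data.Unit using (⊤; tt)
open import Function.Base using (id; _∘_)
open import Function.Bundles using (mk⇔; module Equivalence)
open import Level using (0ℓ)
open import Relation.Binary.Definitions using (Tri; tri<; tri≈; tri>)
open import Relation.Binary.PropositionalEquality
  using (_≡_; _≗_; refl; sym; trans; cong; cong₂; subst; subst₂)
open import Relation.Nullary using (Dec; ¬_; yes; no)
open import Relation.Unary using (Pred; _⊆_; _∈_)

-- Pairing, and finite lists coded as numbers.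

left-pair : ∀ a b → left ⟪ a , b ⟫ ≡ a
left-pair a b = cong proj₁ (unpair-pair a b)

right-pair : ∀ a b → right ⟪ a , b ⟫ ≡ b
right-pair a b = cong proj₂ (unpair-pair a b)

pair-next : ∀ a b → ⟪ proj₁ (next (a , b)) , proj₂ (next (a , b)) ⟫ ≡ suc ⟪ a , b ⟫
pair-next a zero rewrite +-identityʳ a | +-identityʳ (a + triangle a) = cong suc (+-comm a (triangle a))
pair-next a (suc b) rewrite +-suc a b = +-suc _ a

pair-unpair : ∀ n → ⟪ left n , right n ⟫ ≡ n
pair-unpair zero    = refl
pair-unpair (suc n) = trans (pair-next (left n) (right n)) (cong suc (pair-unpair n))

natrec : ℕ → (ℕ → ℕ → ℕ) → ℕ → ℕ
natrec z s zero    = z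
natrec z s (suc n) = s n (natrec z s n)

caseℕ : ℕ → ℕ → (ℕ → ℕ) → ℕ
caseℕ zero    z s = z
caseℕ (suc n) z s = s n

-- Tests are numbers, with 0 for truth: conjunctions become sums.
sumBelow : (ℕ → ℕ) → ℕ → ℕ
sumBelow p zero    = 0
sumBelow p (suc n) = p n + sumBelow p n

isZero : ℕ → ℕ
isZero n = caseℕ n 1 (λ _ → 0)

tailℕ : ℕ → ℕ
tailℕ w = right (pred w)

dropℕ : ℕ → ℕ → ℕ
dropℕ w = natrec w (λ _ → tailℕ)

-- Past the end of the list the value is 0, because `dropℕ` stays at 0 and `left 0` is 0; so
-- `nth ⌜ σ ⌝` is the string `σ` followed by zeros.
nth : ℕ → ℕ → ℕ
nth w i = left (pred (dropℕ w i))

dropℕ-tail : ∀ w i → dropℕ w (suc i) ≡ dropℕ (tailℕ w) i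
dropℕ-tail w zero    = refl
dropℕ-tail w (suc i) = cong tailℕ (dropℕ-tail w i)

nth-zero : ∀ a w → nth (suc ⟪ a , w ⟫) 0 ≡ a
nth-zero = left-pair

nth-suc : ∀ a w i → nth (suc ⟪ a , w ⟫) (suc i) ≡ nth w i
nth-suc a w i = cong (left ∘ pred)
  (trans (dropℕ-tail _ i) (cong (λ v → dropℕ v i) (right-pair a w)))

dropℕ-nil : ∀ i → dropℕ 0 i ≡ 0
dropℕ-nil zero    = refl
dropℕ-nil (suc i) rewrite dropℕ-nil i = refl

nth-nil : ∀ i → nth 0 i ≡ 0
nth-nil i = cong (left ∘ pred) (dropℕ-nil i)

nth-↾ : ∀ x {i n} → i < n → nth ⌜ x ↾ n ⌝ i ≡ x i
nth-↾ x {zero}  {suc n} _     = nth-zero (x 0) _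
nth-↾ x {suc i} {suc n} 1+i<n = trans (nth-suc (x 0) _ i) (nth-↾ (x ∘ suc) (s≤s⁻¹ 1+i<n))

nth-↾-beyond : ∀ x {i n} → n ≤ i → nth ⌜ x ↾ n ⌝ i ≡ 0
nth-↾-beyond x {i}     {zero}  _   = nth-nil i
nth-↾-beyond x {suc i} {suc n} n≤i = trans (nth-suc (x 0) _ i) (nth-↾-beyond (x ∘ suc) (s≤s⁻¹ n≤i))

dropℕ-length : ∀ σ → dropℕ ⌜ σ ⌝ (length σ) ≡ 0
dropℕ-length []      = refl
dropℕ-length (a ∷ σ) = trans (dropℕ-tail _ (length σ))
  (trans (cong (λ v → dropℕ v (length σ)) (right-pair a ⌜ σ ⌝)) (dropℕ-length σ))

dropℕ-<length : ∀ σ {i} → i < length σ → ∃[ w ] dropℕ ⌜ σ ⌝ i ≡ suc w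
dropℕ-<length (a ∷ σ) {zero}  _   = _ , refl
dropℕ-<length (a ∷ σ) {suc i} i<n with dropℕ-<length σ (s≤s⁻¹ i<n)
... | w , eq = w , trans (dropℕ-tail _ i) (trans (cong (λ v → dropℕ v i) (right-pair a ⌜ σ ⌝)) eq)

liftᶜ : ∀ {O} → Code ⊥ → Code O
liftᶜ zeroᶜ       = zeroᶜ
liftᶜ succᶜ       = succᶜ
liftᶜ leftᶜ       = leftᶜ
liftᶜ rightᶜ      = rightᶜ
liftᶜ (pairᶜ c d) = pairᶜ (liftᶜ c) (liftᶜ d)
liftᶜ (compᶜ c d) = compᶜ (liftᶜ c) (liftᶜ d)
liftᶜ (precᶜ c d) = precᶜ (liftᶜ c) (liftᶜ d)
liftᶜ (μᶜ c)      = μᶜ (liftᶜ c)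

lift⇓ : ∀ {O} {g : O → ℕ → ℕ} {c n y} → noOracle ⊢ c [ n ]⇓ y → g ⊢ liftᶜ c [ n ]⇓ y
lift⇓ zero⇓             = zero⇓
lift⇓ succ⇓             = succ⇓
lift⇓ left⇓             = left⇓
lift⇓ right⇓            = right⇓
lift⇓ (pair⇓ p q)       = pair⇓ (lift⇓ p) (lift⇓ q)
lift⇓ (comp⇓ p q)       = comp⇓ (lift⇓ p) (lift⇓ q)
lift⇓ (prec-zero⇓ e p)  = prec-zero⇓ e (lift⇓ p)
lift⇓ (prec-suc⇓ e p q) = prec-suc⇓ e (lift⇓ p) (lift⇓ q)
lift⇓ (μ⇓ w h p)        = μ⇓ w (λ z z<y → lift⇓ (h z z<y)) (lift⇓ p)

applyUpTo-cong : ∀ {f g : ℕ → ℕ} n → (∀ i → i < n → f i ≡ g i) → applyUpTo f n ≡ applyUpTo g n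
applyUpTo-cong zero    eq = refl
applyUpTo-cong (suc n) eq =
  cong₂ _∷_ (eq 0 (s≤s z≤n)) (applyUpTo-cong n (λ i i<n → eq (suc i) (s≤s i<n)))

-- The known zero bounds the search: each positive value passed shifts `p` and lowers the bound by
-- one.
leastZero : (p : ℕ → ℕ) → ∀ {z} → p z ≡ 0 →
            ∃[ m ] p m ≡ 0 × (∀ j → j < m → ∃[ v ] p j ≡ suc v)
leastZero p {z} pz≡0 with p 0 in eq
... | zero = 0 , eq , λ _ ()
leastZero p {zero}  pz≡0 | suc v with () ← trans (sym eq) pz≡0
leastZero p {suc z} pz≡0 | suc v with leastZero (p ∘ suc) pz≡0
... | m , pm≡0 , below = suc m , pm≡0 , λ where
  zero    _   → v , eq
  (suc j) j<m → below j (s≤s⁻¹ j<m)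

-- Codes built together with proofs of what they compute.

-- An input is an element of I together with finitely many numbers, the most
-- recently bound one first; it is presented to a code by its nested pairing.
module Programs {I O : Set} (encodeInput : I → ℕ) (oracles : I → O → ℕ → ℕ) where

  Env : ℕ → Set
  Env zero    = I
  Env (suc k) = ℕ × Env k

  encodeEnv : ∀ k → Env k → ℕ
  encodeEnv zero    i       = encodeInput i
  encodeEnv (suc k) (n , ρ) = ⟪ n , encodeEnv k ρ ⟫

  oraclesOf : ∀ k → Env k → O → ℕ → ℕ
  oraclesOf zero    i       = oracles i
  oraclesOf (suc k) (_ , ρ) = oraclesOf k ρ

  record Program k (f : Env k → ℕ) : Set where
    constructor program
    field
      code : Code O
      runs : ∀ ρ → oraclesOf k ρ ⊢ code [ encodeEnv k ρ ]⇓ f ρ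
  open Program public

  private
    variable
      k : ℕ
      f g h : Env k → ℕ

    idᶜ : Code O
    idᶜ = pairᶜ leftᶜ rightᶜ

    id⇓ : ∀ {g : O → ℕ → ℕ} n → g ⊢ idᶜ [ n ]⇓ n
    id⇓ n = subst (_ ⊢ idᶜ [ n ]⇓_) (pair-unpair n) (pair⇓ left⇓ right⇓)

    leftOf⇓ : ∀ {g : O → ℕ → ℕ} a b → g ⊢ leftᶜ [ ⟪ a , b ⟫ ]⇓ a
    leftOf⇓ a b = subst (_ ⊢ leftᶜ [ ⟪ a , b ⟫ ]⇓_) (left-pair a b) left⇓

    rightOf⇓ : ∀ {g : O → ℕ → ℕ} a b → g ⊢ rightᶜ [ ⟪ a , b ⟫ ]⇓ b
    rightOf⇓ a b = subst (_ ⊢ rightᶜ [ ⟪ a , b ⟫ ]⇓_) (right-pair a b) right⇓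

  respᵖ : (∀ (ρ : Env k) → f ρ ≡ g ρ) → Program k f → Program k g
  respᵖ f≗g (program c r) = program c λ ρ → subst (_ ⊢ c [ _ ]⇓_) (f≗g ρ) (r ρ)

  inputᵖ : Program 0 encodeInput
  inputᵖ = program idᶜ λ _ → id⇓ _

  hereᵖ : Program (suc k) proj₁
  hereᵖ = program leftᶜ λ (a , _) → leftOf⇓ a _

  weakenᵖ : Program k f → Program (suc k) (λ (_ , ρ) → f ρ)
  weakenᵖ (program c r) = program (compᶜ c rightᶜ) λ (a , ρ) → comp⇓ (rightOf⇓ a _) (r ρ)

  -- Keeps the newest variable and drops the one beneath it, so that a function of a bound variable
  -- can be used under a further binder.
  weaken¹ᵖ : Program (suc k) f → Program (suc (suc k)) (λ (a , _ , ρ) → f (a , ρ))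
  weaken¹ᵖ (program c r) = program (compᶜ c (pairᶜ leftᶜ (compᶜ rightᶜ rightᶜ))) λ (a , b , ρ) →
    comp⇓ (pair⇓ (leftOf⇓ a _) (comp⇓ (rightOf⇓ a _) (rightOf⇓ b _))) (r (a , ρ))

  letᵖ : Program k f → Program (suc k) g → Program k (λ ρ → g (f ρ , ρ))
  letᵖ (program c r) (program d s) = program (compᶜ d (pairᶜ c idᶜ)) λ ρ →
    comp⇓ (pair⇓ (r ρ) (id⇓ _)) (s _)

  sucᵖ : Program k f → Program k (λ ρ → suc (f ρ))
  sucᵖ (program c r) = program (compᶜ succᶜ c) λ ρ → comp⇓ (r ρ) succ⇓

  constᵖ : ∀ n → Program k (λ _ → n)
  constᵖ zero    = program zeroᶜ λ _ → zero⇓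
  constᵖ (suc n) = sucᵖ (constᵖ n)

  pairᵖ : Program k f → Program k g → Program k (λ ρ → ⟪ f ρ , g ρ ⟫)
  pairᵖ (program c r) (program d s) = program (pairᶜ c d) λ ρ → pair⇓ (r ρ) (s ρ)

  leftᵖ : Program k f → Program k (λ ρ → left (f ρ))
  leftᵖ (program c r) = program (compᶜ leftᶜ c) λ ρ → comp⇓ (r ρ) left⇓

  rightᵖ : Program k f → Program k (λ ρ → right (f ρ))
  rightᵖ (program c r) = program (compᶜ rightᶜ c) λ ρ → comp⇓ (r ρ) right⇓

  oracleᵖ : ∀ o → Program k f → Program k (λ ρ → oraclesOf k ρ o (f ρ))
  oracleᵖ o (program c r) = program (compᶜ (oracleᶜ o) c) λ ρ → comp⇓ (r ρ) oracle⇓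

  natrecᵖ : Program k f → Program (suc (suc k)) g → Program k h →
            Program k (λ ρ → natrec (f ρ) (λ m v → g (m , v , ρ)) (h ρ))
  natrecᵖ {k} {f} {g} {h} (program c r) (program d s) (program e t) =
    program (compᶜ (precᶜ c d′) (pairᶜ idᶜ e)) λ ρ → comp⇓ (pair⇓ (id⇓ _) (t ρ)) (loop ρ (h ρ))
    where
    d′ : Code O
    -- `precᶜ` supplies the parameter, the counter and the previous value in this order; the
    -- environment has the parameter last.
    d′ = compᶜ d (pairᶜ (compᶜ leftᶜ rightᶜ) (pairᶜ (compᶜ rightᶜ rightᶜ) leftᶜ))

    loop : ∀ ρ n → oraclesOf k ρ ⊢ precᶜ c d′ [ ⟪ encodeEnv k ρ , n ⟫ ]⇓
                   natrec (f ρ) (λ m v → g (m , v , ρ)) n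
    loop ρ zero    = prec-zero⇓ (right-pair (encodeEnv k ρ) 0)
      (subst (oraclesOf k ρ ⊢ c [_]⇓ _) (sym (left-pair (encodeEnv k ρ) 0)) (r ρ))
    loop ρ (suc n) = prec-suc⇓ (right-pair e₀ (suc n))
      (subst (λ p → oraclesOf k ρ ⊢ precᶜ c d′ [ ⟪ p , n ⟫ ]⇓ v)
             (sym (left-pair e₀ (suc n))) (loop ρ n))
      (subst (λ p → oraclesOf k ρ ⊢ d′ [ ⟪ p , ⟪ n , v ⟫ ⟫ ]⇓ g (n , v , ρ))
             (sym (left-pair e₀ (suc n)))
        (comp⇓ (pair⇓ (comp⇓ (rightOf⇓ e₀ ⟪ n , v ⟫) (leftOf⇓ n v))
                      (pair⇓ (comp⇓ (rightOf⇓ e₀ ⟪ n , v ⟫) (rightOf⇓ n v)) (leftOf⇓ e₀ ⟪ n , v ⟫)))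
               (s (n , v , ρ))))
      where
      e₀ = encodeEnv k ρ
      v  = natrec (f ρ) (λ m v → g (m , v , ρ)) n

  μᵖ : Program (suc k) f → (m : Env k → ℕ) → (∀ ρ → f (m ρ , ρ) ≡ 0) →
       (∀ ρ j → j < m ρ → ∃[ v ] f (j , ρ) ≡ suc v) → Program k m
  μᵖ {k} {f} (program c r) m zeroAt below = program (μᶜ c′) λ ρ →
    μ⇓ (λ z → pred (f (z , ρ)))
       (λ z z<m → subst (_ ⊢ c′ [ _ ]⇓_) (positive (below ρ z z<m)) (run ρ z))
       (subst (_ ⊢ c′ [ _ ]⇓_) (zeroAt ρ) (run ρ (m ρ)))
    where
    c′ : Code O
    c′ = compᶜ c (pairᶜ rightᶜ leftᶜ)

    run : ∀ ρ z → oraclesOf k ρ ⊢ c′ [ ⟪ encodeEnv k ρ , z ⟫ ]⇓ f (z , ρ)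
    run ρ z = comp⇓ (pair⇓ (rightOf⇓ (encodeEnv k ρ) z) (leftOf⇓ (encodeEnv k ρ) z)) (r (z , ρ))

    positive : ∀ {n} → ∃[ v ] n ≡ suc v → n ≡ suc (pred n)
    positive (_ , refl) = refl

  -- The witness from `ex`, however it was obtained, only shows that the search ends; the program
  -- itself looks for the least zero.
  searchᵖ : Program (suc k) f → (∀ (ρ : Env k) → ∃[ z ] f (z , ρ) ≡ 0) →
            ∃[ m ] Program k m × (∀ ρ → f (m ρ , ρ) ≡ 0)
  searchᵖ {f = f} F ex = m , μᵖ F m (proj₁ ∘ proj₂ ∘ least) (proj₂ ∘ proj₂ ∘ least) , proj₁ ∘ proj₂ ∘ least
    where
    least = λ ρ → leastZero (λ z → f (z , ρ)) (proj₂ (ex ρ))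
    m     = proj₁ ∘ least

  caseᵖ : Program k f → Program k g → Program (suc k) h →
          Program k (λ ρ → caseℕ (f ρ) (g ρ) (λ n → h (n , ρ)))
  caseᵖ {f = f} {g} {h} F G H = respᵖ (λ ρ → agree ρ (f ρ)) (natrecᵖ G (weaken¹ᵖ H) F)
    where
    agree : ∀ ρ n → natrec (g ρ) (λ m _ → h (m , ρ)) n ≡ caseℕ n (g ρ) (λ n → h (n , ρ))
    agree ρ zero    = refl
    agree ρ (suc n) = refl

  predᵖ : Program k f → Program k (λ ρ → pred (f ρ))
  predᵖ {f = f} F = respᵖ (λ ρ → agree (f ρ)) (caseᵖ F (constᵖ 0) hereᵖ)
    where
    agree : ∀ n → caseℕ n 0 id ≡ pred n
    agree zero    = refl
    agree (suc n) = refl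

  isZeroᵖ : Program k f → Program k (λ ρ → isZero (f ρ))
  isZeroᵖ F = caseᵖ F (constᵖ 1) (constᵖ 0)

  infixl 6 _+ᵖ_ _∸ᵖ_

  _+ᵖ_ : Program k f → Program k g → Program k (λ ρ → f ρ + g ρ)
  _+ᵖ_ {f = f} {g} F G = respᵖ (λ ρ → agree (f ρ) (g ρ)) (natrecᵖ G (sucᵖ (weakenᵖ hereᵖ)) F)
    where
    agree : ∀ m n → natrec n (λ _ → suc) m ≡ m + n
    agree zero    n = refl
    agree (suc m) n = cong suc (agree m n)

  _∸ᵖ_ : Program k f → Program k g → Program k (λ ρ → f ρ ∸ g ρ)
  _∸ᵖ_ {f = f} {g} F G = respᵖ (λ ρ → agree (f ρ) (g ρ)) (natrecᵖ F (predᵖ (weakenᵖ hereᵖ)) G)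
    where
    agree : ∀ m n → natrec m (λ _ → pred) n ≡ m ∸ n
    agree m zero    = refl
    agree m (suc n) = trans (cong pred (agree m n)) (pred[m∸n]≡m∸[1+n] m n)

  sumBelowᵖ : Program (suc k) f → Program k g →
              Program k (λ ρ → sumBelow (λ i → f (i , ρ)) (g ρ))
  sumBelowᵖ {f = f} {g} F G = respᵖ (λ ρ → agree ρ (g ρ))
    (natrecᵖ (constᵖ 0) (weaken¹ᵖ F +ᵖ weakenᵖ hereᵖ) G)
    where
    agree : ∀ ρ n → natrec 0 (λ m v → f (m , ρ) + v) n ≡ sumBelow (λ i → f (i , ρ)) n
    agree ρ zero    = refl
    agree ρ (suc n) = cong (f (n , ρ) +_) (agree ρ n)

  dropᵖ : Program k f → Program k g → Program k (λ ρ → dropℕ (f ρ) (g ρ))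
  dropᵖ F G = natrecᵖ F (rightᵖ (predᵖ (weakenᵖ hereᵖ))) G

  nthᵖ : Program k f → Program k g → Program k (λ ρ → nth (f ρ) (g ρ))
  nthᵖ F G = leftᵖ (predᵖ (dropᵖ F G))

  -- List codes grow at the head, so the prefix is built from its last entry backwards: after `m`
  -- rounds the entries from `n ∸ m` on are present.
  ↾ᵖ : Program (suc k) f → Program k g → Program k (λ ρ → ⌜ (λ i → f (i , ρ)) ↾ g ρ ⌝)
  ↾ᵖ {f = f} {g} F G = respᵖ
    (λ ρ → trans (agree ρ (g ρ) (g ρ) ≤-refl)
                 (cong ⌜_⌝ (applyUpTo-cong (g ρ) (λ i _ → cong (λ j → f (j + i , ρ)) (n∸n≡0 (g ρ))))))
    (natrecᵖ (constᵖ 0)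
      (sucᵖ (pairᵖ (letᵖ (weakenᵖ (weakenᵖ G) ∸ᵖ sucᵖ hereᵖ) (weaken¹ᵖ (weaken¹ᵖ F))) (weakenᵖ hereᵖ)))
      G)
    where
    agree : ∀ ρ n m → m ≤ n →
            natrec 0 (λ j v → suc ⟪ f (n ∸ suc j , ρ) , v ⟫) m ≡
            ⌜ applyUpTo (λ i → f (n ∸ m + i , ρ)) m ⌝
    agree ρ n zero    _   = refl
    agree ρ n (suc m) m<n = cong suc (cong₂ ⟪_,_⟫
      (cong (λ j → f (j , ρ)) (sym (+-identityʳ _)))
      (trans (agree ρ n m (<⇒≤ m<n)) (cong ⌜_⌝ (applyUpTo-cong m λ i _ →
        cong (λ j → f (j , ρ))
          (trans (cong (_+ i) (+-∸-assoc 1 m<n)) (sym (+-suc (n ∸ suc m) i)))))))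

  onString : ∀ {Ψ} → ComputableOnStrings Ψ → Program (suc k) f → Program k g →
             Program k (λ ρ → Ψ ((λ i → f (i , ρ)) ↾ g ρ))
  onString (c , c⇓) F G = program (compᶜ (liftᶜ c) (code (↾ᵖ F G))) λ ρ →
    comp⇓ (runs (↾ᵖ F G) ρ) (lift⇓ (c⇓ _))

-- Finite approximations of computations with an oracle.

-- A number w stands for the finite partial oracle whose value at i is y when
-- nth w i ≡ suc y and which is undefined at i when nth w i ≡ 0.
Ext : Baire → ℕ → Set
Ext x w = ∀ i y → nth w i ≡ suc y → x i ≡ y

Ext-nil : ∀ {x} → Ext x 0
Ext-nil i y eq with () ← trans (sym (nth-nil i)) eq

Agrees : ℕ → Baire → ℕ → Set
Agrees N x w = ∀ i → i < N → nth w i ≡ suc (x i)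

-- State of the search for a zero: 0 when a value is missing, 1 while
-- searching, suc (suc y) when y has been found.
searchStep : (ℕ → ℕ) → ℕ → ℕ → ℕ
searchStep a z st =
  caseℕ st 0 (λ st′ → caseℕ st′ (caseℕ (a z) 0 (λ v → caseℕ v (suc (suc z)) (λ _ → 1)))
                                (λ y → suc (suc y)))

searchState : (ℕ → ℕ) → ℕ → ℕ
searchState a = natrec 1 (searchStep a)

-- The result is 0 if the computation does not halt within the resources s,
-- which only bound the μ-searches, and suc of the output otherwise.
ev : Code ⊤ → ℕ → ℕ → ℕ → ℕ
ev zeroᶜ        w s n = 1
ev succᶜ        w s n = suc (suc n)
ev leftᶜ        w s n = suc (left n)
ev rightᶜ       w s n = suc (right n)
ev (oracleᶜ tt) w s n = nth w n
ev (pairᶜ c d)  w s n = caseℕ (ev c w s n) 0 λ a → caseℕ (ev d w s n) 0 λ b → suc ⟪ a , b ⟫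
ev (compᶜ c d)  w s n = caseℕ (ev d w s n) 0 (ev c w s)
ev (precᶜ c d)  w s n =
  natrec (ev c w s (left n)) (λ m v → caseℕ v 0 λ u → ev d w s ⟪ left n , ⟪ m , u ⟫ ⟫) (right n)
ev (μᶜ c)       w s n = pred (searchState (λ z → ev c w s ⟪ n , z ⟫) s)

caseℕ-suc : ∀ x f {y} → caseℕ x 0 f ≡ suc y → ∃[ a ] x ≡ suc a × f a ≡ suc y
caseℕ-suc (suc a) f eq = a , refl , eq

-- The values of `a` are shifted by one: 0 is undefined, 1 is the value zero, and `suc (suc v)` is a
-- positive value.
SearchInvariant : (ℕ → ℕ) → ℕ → ℕ → Set
SearchInvariant a z zero          = ⊤
SearchInvariant a z (suc zero)    = ∀ j → j < z → ∃[ v ] a j ≡ suc (suc v)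
SearchInvariant a z (suc (suc y)) = a y ≡ 1 × (∀ j → j < y → ∃[ v ] a j ≡ suc (suc v))

searchStep-invariant : ∀ a z st → SearchInvariant a z st →
                       SearchInvariant a (suc z) (searchStep a z st)
searchStep-invariant a z zero          inv = tt
searchStep-invariant a z (suc (suc y)) inv = inv
searchStep-invariant a z (suc zero)    inv with a z in eq
... | zero        = tt
... | suc zero    = eq , inv
... | suc (suc v) = λ j j<1+z → case≤ j (m≤n⇒m<n∨m≡n (s≤s⁻¹ j<1+z))
  where
  case≤ : ∀ j → (j < z ⊎ j ≡ z) → ∃[ v ] a j ≡ suc (suc v)
  case≤ j (inj₁ j<z)  = inv j j<z
  case≤ j (inj₂ refl) = v , eq

searchState-invariant : ∀ a s → SearchInvariant a s (searchState a s)
searchState-invariant a zero    j ()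
searchState-invariant a (suc s) = searchStep-invariant a s _ (searchState-invariant a s)

searchState-before : ∀ a s → (∀ j → j < s → ∃[ v ] a j ≡ suc (suc v)) → searchState a s ≡ 1
searchState-before a zero    _     = refl
searchState-before a (suc s) below
  rewrite searchState-before a s (λ j j<s → below j (m<n⇒m<1+n j<s))
        | proj₂ (below s ≤-refl) = refl

-- The zero is recorded in the round for `y`, and a state with a result is never left.
searchState-after : ∀ a y d → a y ≡ 1 → (∀ j → j < y → ∃[ v ] a j ≡ suc (suc v)) →
                    searchState a (d + suc y) ≡ suc (suc y)
searchState-after a y zero    ay≡1 below rewrite searchState-before a y below | ay≡1 = refl
searchState-after a y (suc d) ay≡1 below rewrite searchState-after a y d ay≡1 below = refl

-- Every value that `ev` takes from `w` is a value of `x`, so a result obtained from a partial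
-- oracle is valid for all of its extensions.
ev-sound : ∀ {x w} → Ext x w → ∀ c {s n y} → ev c w s n ≡ suc y → (λ _ → x) ⊢ c [ n ]⇓ y
ev-sound ext zeroᶜ  refl = zero⇓
ev-sound ext succᶜ  refl = succ⇓
ev-sound ext leftᶜ  refl = left⇓
ev-sound ext rightᶜ refl = right⇓
ev-sound ext (oracleᶜ tt) {n = n} eq = subst (_ ⊢ oracleᶜ tt [ _ ]⇓_) (ext n _ eq) oracle⇓
ev-sound {w = w} ext (pairᶜ c d) {s} {n} eq
  with a , eq₁ , eq′ ← caseℕ-suc (ev c w s n) _ eq
  with b , eq₂ , refl ← caseℕ-suc (ev d w s n) _ eq′
  = pair⇓ (ev-sound ext c eq₁) (ev-sound ext d eq₂)
ev-sound {w = w} ext (compᶜ c d) {s} {n} eq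
  with a , eq₁ , eq₂ ← caseℕ-suc (ev d w s n) _ eq
  = comp⇓ (ev-sound ext d eq₁) (ev-sound ext c eq₂)
ev-sound {x} {w} ext (precᶜ c d) {s} {n} eq = go (left n) n (right n) refl refl eq
  where
  go : ∀ p n r {y} → left n ≡ p → right n ≡ r →
       natrec (ev c w s p) (λ m v → caseℕ v 0 λ u → ev d w s ⟪ p , ⟪ m , u ⟫ ⟫) r ≡ suc y →
       (λ _ → x) ⊢ precᶜ c d [ n ]⇓ y
  go p n zero    refl r≡ eq = prec-zero⇓ r≡ (ev-sound ext c eq)
  go p n (suc r) refl r≡ eq with u , eq₁ , eq₂ ← caseℕ-suc (natrec _ _ r) _ eq =
    prec-suc⇓ r≡ (go p ⟪ left n , r ⟫ r (left-pair (left n) r) (right-pair (left n) r) eq₁)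
              (ev-sound ext d eq₂)
ev-sound {x} {w} ext (μᶜ c) {s} {n} eq
  with searchState (λ z → ev c w s ⟪ n , z ⟫) s | searchState-invariant (λ z → ev c w s ⟪ n , z ⟫) s
ev-sound {x} {w} ext (μᶜ c) {s} {n} refl | suc (suc y) | eq , below =
  μ⇓ (λ z → pred (pred (ev c w s ⟪ n , z ⟫)))
     (λ z z<y → ev-sound ext c (positive (below z z<y))) (ev-sound ext c eq)
  where
  positive : ∀ {m} → ∃[ v ] m ≡ suc (suc v) → m ≡ suc (suc (pred (pred m)))
  positive (_ , refl) = refl

Agrees-≤ : ∀ {M N x w} → M ≤ N → Agrees N x w → Agrees M x w
Agrees-≤ M≤N agr i i<M = agr i (≤-trans i<M M≤N)

eventuallyBelow : ∀ {S : ℕ → ℕ → Set} → (∀ i {M N} → M ≤ N → S i M → S i N) →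
                  ∀ n → (∀ i → i < n → ∃[ N ] S i N) → ∃[ N ] (∀ i → i < n → S i N)
eventuallyBelow mono zero    ex = 0 , λ _ ()
eventuallyBelow {S} mono (suc n) ex
  with N₁ , h₁ ← eventuallyBelow {S} mono n (λ i i<n → ex i (m<n⇒m<1+n i<n))
  with N₂ , h₂ ← ex n ≤-refl = N₁ ⊔ N₂ , λ i i<1+n → pick i (m≤n⇒m<n∨m≡n (s≤s⁻¹ i<1+n))
  where
  pick : ∀ i → (i < n ⊎ i ≡ n) → S i (N₁ ⊔ N₂)
  pick i (inj₁ i<n)  = mono i (m≤m⊔n N₁ N₂) (h₁ i i<n)
  pick i (inj₂ refl) = mono i (m≤n⊔m N₁ N₂) h₂

Completeness : Code ⊤ → Baire → ℕ → ℕ → ℕ → Set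
Completeness c x n y N = ∀ s w → N ≤ s → Agrees N x w → ev c w s n ≡ suc y

completeness-mono : ∀ c {x n y M N} → M ≤ N → Completeness c x n y M → Completeness c x n y N
completeness-mono c M≤N h s w N≤s agr = h s w (≤-trans M≤N N≤s) (Agrees-≤ {w = w} M≤N agr)

-- The use principle: a halting computation reads finitely many oracle values and makes finitely
-- many searches, so one bound serves for both.
ev-complete : ∀ {x c n y} → (λ _ → x) ⊢ c [ n ]⇓ y → ∃[ N ] Completeness c x n y N
ev-complete zero⇓  = 0 , λ _ _ _ _ → refl
ev-complete succ⇓  = 0 , λ _ _ _ _ → refl
ev-complete left⇓  = 0 , λ _ _ _ _ → refl
ev-complete right⇓ = 0 , λ _ _ _ _ → refl
ev-complete (oracle⇓ {n = n}) = suc n , λ _ _ _ agr → agr n ≤-refl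
ev-complete (pair⇓ {c} {d} p q)
  with N₁ , h₁ ← ev-complete p | N₂ , h₂ ← ev-complete q = N₁ ⊔ N₂ , λ s w N≤s agr → both
    (completeness-mono c (m≤m⊔n N₁ N₂) h₁ s w N≤s agr)
    (completeness-mono d (m≤n⊔m N₁ N₂) h₂ s w N≤s agr)
  where
  both : ∀ {u v a b} → u ≡ suc a → v ≡ suc b →
         caseℕ u 0 (λ a → caseℕ v 0 λ b → suc ⟪ a , b ⟫) ≡ suc ⟪ a , b ⟫
  both refl refl = refl
ev-complete (comp⇓ {c} {d} p q)
  with N₁ , h₁ ← ev-complete p | N₂ , h₂ ← ev-complete q = N₁ ⊔ N₂ , λ s w N≤s agr →
    trans (cong (λ v → caseℕ v 0 (ev c w s)) (completeness-mono d (m≤m⊔n N₁ N₂) h₁ s w N≤s agr))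
          (completeness-mono c (m≤n⊔m N₁ N₂) h₂ s w N≤s agr)
ev-complete {n = n} (prec-zero⇓ {c} {d} r≡0 p) with N , h ← ev-complete p =
  N , λ s w N≤s agr →
    trans (cong (natrec (ev c w s (left n)) _) r≡0) (h s w N≤s agr)
ev-complete {n = n} (prec-suc⇓ {c} {d} {m = m} {v} r≡1+m p q)
  with N₁ , h₁ ← ev-complete p | N₂ , h₂ ← ev-complete q = N₁ ⊔ N₂ , λ s w N≤s agr →
    trans (cong (natrec (ev c w s (left n)) _) r≡1+m)
    (trans (cong (λ u → caseℕ u 0 (λ u → ev d w s ⟪ left n , ⟪ m , u ⟫ ⟫))
      (trans (sym (unfold s w (left n) m)) (completeness-mono (precᶜ c d) {n = ⟪ left n , m ⟫} (m≤m⊔n N₁ N₂) h₁ s w N≤s agr)))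
      (completeness-mono d (m≤n⊔m N₁ N₂) h₂ s w N≤s agr))
  where
  unfold : ∀ s w p m → ev (precᶜ c d) w s ⟪ p , m ⟫ ≡
           natrec (ev c w s p) (λ m v → caseℕ v 0 λ u → ev d w s ⟪ p , ⟪ m , u ⟫ ⟫) m
  unfold s w p m rewrite left-pair p m | right-pair p m = refl
ev-complete {x} (μ⇓ {c} {n} {y} u below p)
  with N₁ , h₁ ← ev-complete p
     | N₂ , h₂ ← eventuallyBelow (λ _ → completeness-mono c) y (λ z z<y → ev-complete (below z z<y)) =
  N , λ s w N≤s agr → cong pred
    (trans (cong (searchState (λ z → ev c w s ⟪ n , z ⟫)) (sym (m∸n+n≡m (≤-trans (m≤n⊔m _ (suc y)) N≤s))))
      (searchState-after _ y (s ∸ suc y)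
        (completeness-mono c (≤-trans (m≤m⊔n N₁ N₂) (m≤m⊔n _ _)) h₁ s w N≤s agr)
        (λ z z<y → u z , completeness-mono c (≤-trans (m≤n⊔m N₁ N₂) (m≤m⊔n _ _)) (h₂ z z<y) s w N≤s agr)))
  where
  -- A search takes `suc y` rounds to test the candidates up to and including `y`.
  N = N₁ ⊔ N₂ ⊔ suc y

module _ {I O : Set} (encodeInput : I → ℕ) (oracles : I → O → ℕ → ℕ) where
  open Programs encodeInput oracles

  private
    weaken³ : ∀ {k} {f : Env k → ℕ} → Program k f → Program _ (λ (_ , _ , _ , ρ) → f ρ)
    weaken³ F = weakenᵖ (weakenᵖ (weakenᵖ F))

  -- The recursion on `c` happens outside the programs: each fixed code gets a program of its own,
  -- rather than an input to a universal machine.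
  evᵖ : ∀ {k} {f g h : Env k → ℕ} c → Program k f → Program k g → Program k h →
        Program k (λ ρ → ev c (f ρ) (g ρ) (h ρ))
  evᵖ zeroᶜ        W S N = constᵖ 1
  evᵖ succᶜ        W S N = sucᵖ (sucᵖ N)
  evᵖ leftᶜ        W S N = sucᵖ (leftᵖ N)
  evᵖ rightᶜ       W S N = sucᵖ (rightᵖ N)
  evᵖ (oracleᶜ tt) W S N = nthᵖ W N
  evᵖ (pairᶜ c d)  W S N = caseᵖ (evᵖ c W S N) (constᵖ 0)
    (caseᵖ (evᵖ d (weakenᵖ W) (weakenᵖ S) (weakenᵖ N)) (constᵖ 0)
      (sucᵖ (pairᵖ (weakenᵖ hereᵖ) hereᵖ)))
  evᵖ (compᶜ c d)  W S N = caseᵖ (evᵖ d W S N) (constᵖ 0) (evᵖ c (weakenᵖ W) (weakenᵖ S) hereᵖ)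
  evᵖ (precᶜ c d)  W S N = natrecᵖ (evᵖ c W S (leftᵖ N))
    (caseᵖ (weakenᵖ hereᵖ) (constᵖ 0)
      (evᵖ d (weaken³ W) (weaken³ S)
        (pairᵖ (leftᵖ (weaken³ N)) (pairᵖ (weakenᵖ hereᵖ) hereᵖ))))
    (rightᵖ N)
  evᵖ (μᶜ c)       W S N = predᵖ (natrecᵖ (constᵖ 1)
    (caseᵖ (weakenᵖ hereᵖ) (constᵖ 0)
      (caseᵖ hereᵖ
        (caseᵖ (evᵖ c (weaken³ W) (weaken³ S) (pairᵖ (weaken³ N) (weakenᵖ hereᵖ))) (constᵖ 0)
          (caseᵖ hereᵖ (sucᵖ (sucᵖ (weakenᵖ (weakenᵖ hereᵖ)))) (constᵖ 1)))
        (sucᵖ (sucᵖ hereᵖ))))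
    S)

-- Numerical tests and closed programs.

sumBelow-zero : ∀ p n → sumBelow p n ≡ 0 → ∀ i → i < n → p i ≡ 0
sumBelow-zero p (suc n) eq i i<1+n with m≤n⇒m<n∨m≡n (s≤s⁻¹ i<1+n)
... | inj₁ i<n  = sumBelow-zero p n (m+n≡0⇒n≡0 (p n) eq) i i<n
... | inj₂ refl = m+n≡0⇒m≡0 (p n) eq

zero-sumBelow : ∀ p n → (∀ i → i < n → p i ≡ 0) → sumBelow p n ≡ 0
zero-sumBelow p zero    h = refl
zero-sumBelow p (suc n) h rewrite h n ≤-refl = zero-sumBelow p n (λ i i<n → h i (m<n⇒m<1+n i<n))

sumBelow-cong : ∀ {p q} n → (∀ i → i < n → p i ≡ q i) → sumBelow p n ≡ sumBelow q n
sumBelow-cong zero    h = refl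
sumBelow-cong (suc n) h =
  cong₂ _+_ (h n ≤-refl) (sumBelow-cong n (λ i i<n → h i (m<n⇒m<1+n i<n)))

isZero-zero : ∀ {n} → isZero n ≡ 0 → ∃[ v ] n ≡ suc v
isZero-zero {suc n} _ = n , refl

pred-zero : ∀ {n} → pred n ≡ 0 → n < 2
pred-zero {zero}     _ = s≤s z≤n
pred-zero {suc zero} _ = s≤s (s≤s z≤n)

zero-pred : ∀ {n} → n < 2 → pred n ≡ 0
zero-pred {zero}  _ = refl
zero-pred {suc n} (s≤s (s≤s z≤n)) = refl

+-zero : ∀ {m n} → m ≡ 0 → n ≡ 0 → m + n ≡ 0
+-zero refl refl = refl

shift : ℕ → Baire → Baire
shift k x i = x (k + i)

module StringPrograms = Programs ⌜_⌝ (λ _ → noOracle)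
module ClosedPrograms = Programs {I = ⊤} (λ _ → 0) (λ _ → noOracle)

-- The length is the least number of tails leading to 0, the code of the empty list.
lengthᵖ : StringPrograms.Program 0 length
lengthᵖ = μᵖ (dropᵖ (weakenᵖ inputᵖ) hereᵖ) length dropℕ-length
  (λ σ _ → dropℕ-<length σ)
  where open StringPrograms

closed-computable : ∀ {f} → ClosedPrograms.Program 1 f → Computable (λ n → f (n , tt))
closed-computable (ClosedPrograms.program c r) =
  compᶜ c (pairᶜ (pairᶜ leftᶜ rightᶜ) zeroᶜ) , λ n →
  comp⇓ (pair⇓ (subst (noOracle ⊢ _ [ n ]⇓_) (pair-unpair n) (pair⇓ left⇓ right⇓)) zero⇓) (r (n , tt))

nth-computable : ∀ w → Computable (nth w)
nth-computable w = closed-computable (nthᵖ (constᵖ w) hereᵖ)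
  where open ClosedPrograms

-- Leaves and the set `Q`.

module Concatenation (R : List ℕ → Bool) (R-computable : ComputableRelation R) where

  defect : List ℕ → ℕ
  defect σ = isZero (if R σ then 1 else 0)

  InP : Baire → Set
  InP x = ∀ n → defect (x ↾ n) ≡ 0

  T⇒defect : ∀ {σ} → T (R σ) → defect σ ≡ 0
  T⇒defect {σ} t with R σ
  ... | true = refl

  defect⇒T : ∀ {σ} → defect σ ≡ 0 → T (R σ)
  defect⇒T {σ} eq with R σ
  ... | true = tt

  InP-resp-≗ : ∀ {x y} → x ≗ y → InP x → InP y
  InP-resp-≗ x≗y h n = trans (cong defect (applyUpTo-cong n (λ i _ → sym (x≗y i)))) (h n)

  firstDefect : Baire → ℕ → ℕ
  firstDefect x k = sumBelow (λ j → defect (x ↾ j)) k + isZero (defect (x ↾ k))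

  -- Taking the first failure makes the leaf unique and lets it depend on `x ↾ k` alone.
  Leaf : Baire → ℕ → Set
  Leaf x k = (∀ j → j < k → defect (x ↾ j) ≡ 0) × ∃[ v ] defect (x ↾ k) ≡ suc v

  firstDefect⇒Leaf : ∀ {x k} → firstDefect x k ≡ 0 → Leaf x k
  firstDefect⇒Leaf {x} {k} eq = sumBelow-zero _ k (m+n≡0⇒m≡0 _ eq) ,
    isZero-zero (m+n≡0⇒n≡0 (sumBelow (λ j → defect (x ↾ j)) k) eq)

  Leaf⇒firstDefect : ∀ {x k} → Leaf x k → firstDefect x k ≡ 0
  Leaf⇒firstDefect {x} {k} (below , _ , eq) =
    +-zero (zero-sumBelow _ k below) (cong isZero eq)

  Leaf-unique : ∀ {x k l} → Leaf x k → Leaf x l → k ≡ l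
  Leaf-unique {k = k} {l} (b , _ , e) (b′ , _ , e′) with <-cmp k l
  ... | tri≈ _ k≡l _ = k≡l
  ... | tri< k<l _ _ with () ← trans (sym (b′ k k<l)) e
  ... | tri> _ _ l<k with () ← trans (sym (b l l<k)) e′

  Leaf-cong : ∀ {x y k} → (∀ i → i < k → x i ≡ y i) → Leaf x k → Leaf y k
  Leaf-cong {x} {y} {k} eq (below , v , e) =
    (λ j j<k → trans (agree j (<⇒≤ j<k)) (below j j<k)) , v , trans (agree k ≤-refl) e
    where
    agree : ∀ j → j ≤ k → defect (y ↾ j) ≡ defect (x ↾ j)
    agree j j≤k = cong defect (applyUpTo-cong j (λ i i<j → sym (eq i (≤-trans i<j j≤k))))

  InP⇒¬Leaf : ∀ {x k} → InP x → ¬ Leaf x k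
  InP⇒¬Leaf {k = k} x∈P (_ , _ , e) with () ← trans (sym (x∈P k)) e

  -- If `k` is a leaf, the part of `x ↾ n` after it must have no defect; shorter parts are tested at
  -- smaller `n`. If `k` is not a leaf, the value 0 lets it pass.
  leafTest : ℕ → Baire → ℕ → ℕ
  leafTest n x k = caseℕ (firstDefect x k) (defect (shift k x ↾ (n ∸ k))) (λ _ → 0)

  prefixTest : ℕ → Baire → ℕ
  prefixTest n x = sumBelow (pred ∘ x) n + sumBelow (leafTest n x) (suc n)

  anyDefect : ℕ → Baire → ℕ
  anyDefect n x = sumBelow (λ j → defect (x ↾ j)) (suc n)

  module _ {x y : Baire} {n : ℕ} (eq : ∀ i → i < n → x i ≡ y i) where
    private
      defect-cong : ∀ j → j ≤ n → defect (x ↾ j) ≡ defect (y ↾ j)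
      defect-cong j j≤n = cong defect (applyUpTo-cong j (λ i i<j → eq i (≤-trans i<j j≤n)))

    anyDefect-cong : anyDefect n x ≡ anyDefect n y
    anyDefect-cong = sumBelow-cong (suc n) (λ j j≤n → defect-cong j (s≤s⁻¹ j≤n))

    prefixTest-cong : prefixTest n x ≡ prefixTest n y
    prefixTest-cong = cong₂ _+_ (sumBelow-cong n (λ i i<n → cong pred (eq i i<n)))
      (sumBelow-cong (suc n) (λ k k≤n → leafTest-cong k (s≤s⁻¹ k≤n)))
      where
      leafTest-cong : ∀ k → k ≤ n → leafTest n x k ≡ leafTest n y k
      leafTest-cong k k≤n = cong₂ (λ a b → caseℕ a b (λ _ → 0))
        (cong₂ _+_ (sumBelow-cong k (λ j j<k → defect-cong j (≤-trans (<⇒≤ j<k) k≤n)))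
                   (cong isZero (defect-cong k k≤n)))
        (cong defect (applyUpTo-cong (n ∸ k) (λ i i<n∸k →
          eq (k + i) (subst (k + i <_) (m+[n∸m]≡n k≤n) (+-monoʳ-< k i<n∸k)))))

  -- A string is tested as a sequence padded with zeros. The tests used at length `n` read only the
  -- first `n` entries, so the padding has no influence.
  onPrefix : (ℕ → Baire → ℕ) → List ℕ → ℕ
  onPrefix t σ = t (length σ) (nth ⌜ σ ⌝)

  onPrefix-↾ : ∀ {t : ℕ → Baire → ℕ} → (∀ {x y n} → (∀ i → i < n → x i ≡ y i) → t n x ≡ t n y) →
               ∀ x n → onPrefix t (x ↾ n) ≡ t n x
  onPrefix-↾ {t} t-cong x n = trans (cong (λ l → t l (nth ⌜ x ↾ n ⌝)) (length-applyUpTo x n))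
    (t-cong (λ i → nth-↾ x))

  RQ : List ℕ → Bool
  RQ σ = onPrefix prefixTest σ ≡ᵇ 0

  Q : Pred Baire 0ℓ
  Q x = ∀ n → T (RQ (x ↾ n))

  T-isZero : ∀ {n} → T (n ≡ᵇ 0) → n ≡ 0
  T-isZero {zero} _ = refl

  isZero-T : ∀ {n} → n ≡ 0 → T (n ≡ᵇ 0)
  isZero-T refl = tt

  module _ {x : Baire} (x∈Q : Q x) where
    private
      test : ∀ n → prefixTest n x ≡ 0
      test n = trans (sym (onPrefix-↾ prefixTest-cong x n)) (T-isZero (x∈Q n))

    Q⊆Cantor : Cantor x
    Q⊆Cantor n = pred-zero (sumBelow-zero (pred ∘ x) (suc n) (m+n≡0⇒m≡0 _ (test (suc n))) n ≤-refl)

    Q-afterLeaf : ∀ {k} → Leaf x k → InP (shift k x)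
    -- The test at length `k + n` examines exactly `n` entries after the leaf.
    Q-afterLeaf {k} leaf n with sumBelow-zero (leafTest (k + n) x) (suc (k + n))
      (m+n≡0⇒n≡0 (sumBelow (pred ∘ x) (k + n)) (test (k + n))) k (s≤s (m≤m+n k n))
    ... | eq rewrite Leaf⇒firstDefect leaf | m+n∸m≡n k n = eq

  -- Sequences without a leaf satisfy the implication vacuously; they are the elements of `P` among
  -- the members of `Q`.
  Q-intro : ∀ {x} → Cantor x → (∀ {k} → Leaf x k → InP (shift k x)) → Q x
  Q-intro {x} x∈2 after n = isZero-T (trans (onPrefix-↾ prefixTest-cong x n)
    (+-zero (zero-sumBelow _ n (λ i _ → zero-pred (x∈2 i)))
            (zero-sumBelow _ (suc n) (λ k _ → pass k))))
    where
    pass : ∀ k → leafTest n x k ≡ 0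
    pass k with firstDefect x k in eq
    ... | zero  = after (firstDefect⇒Leaf eq) (n ∸ k)
    ... | suc _ = refl

  -- Computability of `Q`, of the shift and of the learner.

  module DefectPrograms {I O : Set} (encodeInput : I → ℕ) (oracles : I → O → ℕ → ℕ) where
    open Programs encodeInput oracles public

    defectᵖ : ∀ {k} {f : Env (suc k) → ℕ} {g : Env k → ℕ} → Program (suc k) f → Program k g →
              Program k (λ ρ → defect ((λ i → f (i , ρ)) ↾ g ρ))
    defectᵖ F G = isZeroᵖ (onString R-computable F G)

    firstDefectᵖ : ∀ {k} {f : Env (suc k) → ℕ} {g : Env k → ℕ} → Program (suc k) f → Program k g →
                   Program k (λ ρ → firstDefect (λ i → f (i , ρ)) (g ρ))
    firstDefectᵖ F G = sumBelowᵖ (defectᵖ (weaken¹ᵖ F) hereᵖ) G +ᵖ isZeroᵖ (defectᵖ F G)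

  module StringDefects = DefectPrograms ⌜_⌝ (λ _ → noOracle)

  module _ where
    open StringDefects

    entryᵖ : Program 1 (λ (i , σ) → nth ⌜ σ ⌝ i)
    entryᵖ = nthᵖ (weakenᵖ inputᵖ) hereᵖ

    anyDefectᵖ : Program 0 (onPrefix anyDefect)
    anyDefectᵖ = sumBelowᵖ (defectᵖ (weaken¹ᵖ entryᵖ) hereᵖ) (sucᵖ lengthᵖ)

    prefixTestᵖ : Program 0 (onPrefix prefixTest)
    prefixTestᵖ = sumBelowᵖ (predᵖ entryᵖ) lengthᵖ +ᵖ
      sumBelowᵖ (caseᵖ (firstDefectᵖ (weaken¹ᵖ entryᵖ) hereᵖ)
                       (defectᵖ (letᵖ (weakenᵖ hereᵖ +ᵖ hereᵖ) (weaken¹ᵖ (weaken¹ᵖ entryᵖ)))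
                                (weakenᵖ lengthᵖ ∸ᵖ hereᵖ))
                       (constᵖ 0))
                (sucᵖ lengthᵖ)

    RQ-computable : ComputableRelation RQ
    RQ-computable = code P , runs P
      where
      agree : ∀ n → isZero n ≡ (if n ≡ᵇ 0 then 1 else 0)
      agree zero    = refl
      agree (suc n) = refl
      P = respᵖ (λ σ → agree (onPrefix prefixTest σ)) (isZeroᵖ prefixTestᵖ)

  -- Opaque, because an index is far too large to be normalised in unary.
  opaque
    index : Code ⊤ → ℕ
    index = encode

    index-runs : ∀ {c x n y} → (λ _ → x) ⊢ c [ n ]⇓ y → (λ _ → x) ⊢ decode (index c) [ n ]⇓ y
    index-runs {c} = subst (_ ⊢_[ _ ]⇓ _) (sym (decode-encode c))

  identityIndex : ℕ
  identityIndex = index (oracleᶜ tt)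

  ⊢identity : ∀ x n → (λ _ → x) ⊢ decode identityIndex [ n ]⇓ x n
  ⊢identity x n = index-runs oracle⇓

  -- The leaf belongs to the input, which makes the search for it total, but not to the encoding
  -- `proj₂`: the code receives `n` only and finds the leaf in its oracle.
  module ShiftPrograms =
    DefectPrograms {I = (Σ Baire λ x → ∃ (Leaf x)) × ℕ} {O = ⊤} proj₂ (λ ((x , _) , _) _ → x)

  module _ where
    open ShiftPrograms

    shiftᵖ : Program 0 (λ ((x , k , _) , n) → x (k + n))
    shiftᵖ = oracleᵖ tt (leafᵖ +ᵖ inputᵖ)
      where
      leafᵖ : Program 0 (λ ((_ , k , _) , _) → k)
      leafᵖ = μᵖ (isZeroᵖ (defectᵖ (oracleᵖ tt hereᵖ) hereᵖ)) _
        (λ ((_ , _ , _ , _ , e) , _) → cong isZero e)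
        (λ ((_ , _ , below , _) , _) j j<k → 0 , cong isZero (below j j<k))

  shiftIndex : ℕ
  shiftIndex = index (ShiftPrograms.code shiftᵖ)

  ⊢shift : ∀ {x k} → Leaf x k → ∀ n → (λ _ → x) ⊢ decode shiftIndex [ n ]⇓ shift k x n
  ⊢shift {x} {k} leaf n = index-runs (ShiftPrograms.runs shiftᵖ ((x , k , leaf) , n))

  learner : List ℕ → ℕ
  learner σ = caseℕ (onPrefix anyDefect σ) identityIndex (λ _ → shiftIndex)

  learner-computable : ComputableOnStrings learner
  learner-computable = code L , runs L
    where
    open StringPrograms
    L = caseᵖ anyDefectᵖ (constᵖ identityIndex) (constᵖ shiftIndex)

  learner-before : ∀ {x n} → (∀ j → j ≤ n → defect (x ↾ j) ≡ 0) → learner (x ↾ n) ≡ identityIndex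
  learner-before {x} {n} h = cong (λ t → caseℕ t identityIndex (λ _ → shiftIndex))
    (trans (onPrefix-↾ anyDefect-cong x n) (zero-sumBelow _ (suc n) (λ j j≤n → h j (s≤s⁻¹ j≤n))))

  learner-after : ∀ {x k n} → Leaf x k → k ≤ n → learner (x ↾ n) ≡ shiftIndex
  learner-after {x} {k} {n} (_ , _ , e) k≤n
    rewrite onPrefix-↾ {anyDefect} anyDefect-cong x n with anyDefect n x in eq
  ... | suc _ = refl
  ... | zero with () ← trans (sym (sumBelow-zero _ (suc n) eq k (s≤s k≤n))) e

  Q-resp-≗ : ∀ {x y} → x ≗ y → Q x → Q y
  Q-resp-≗ x≗y x∈Q n = subst (T ∘ RQ) (applyUpTo-cong n (λ i _ → x≗y i)) (x∈Q n)

  -- The learnable reduction of `P` to `Q`.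

  module _ (em : ExcludedMiddle 0ℓ) where

    -- The decision is an argument so that proofs can split on it. Only the function to be learned
    -- refers to it; the learner decides nothing.
    recover : (x : Baire) → Dec (∃ (Leaf x)) → Baire
    recover x (yes (k , _)) = shift k x
    recover x (no _)        = x

    recover-cong : ∀ {x y} d d′ → x ≗ y → recover x d ≗ recover y d′
    recover-cong (yes (k , l)) (yes (k′ , l′)) x≗y i
      with refl ← Leaf-unique (Leaf-cong (λ i _ → x≗y i) l) l′ = x≗y (k + i)
    recover-cong (yes (k , l)) (no ¬l) x≗y = ⊥-elim (¬l (k , Leaf-cong (λ i _ → x≗y i) l))
    recover-cong (no ¬l) (yes (k , l)) x≗y = ⊥-elim (¬l (k , Leaf-cong (λ i _ → sym (x≗y i)) l))
    recover-cong (no _)  (no _)        x≗y = x≗y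

    -- Any defect yields a least one, which is a leaf.
    ¬Leaf⇒InP : ∀ {x} → ¬ ∃ (Leaf x) → InP x
    ¬Leaf⇒InP {x} ¬leaf n with defect (x ↾ n) in eq
    ... | zero  = refl
    ... | suc v with leastZero (λ j → isZero (defect (x ↾ j))) {n} (cong isZero eq)
    ...   | k , e , below = ⊥-elim (¬leaf (k , (λ j j<k → pass (below j j<k)) , isZero-zero e))
      where
      pass : ∀ {n} → ∃[ v ] isZero n ≡ suc v → n ≡ 0
      pass {zero} _ = refl

    recover-InP : ∀ {x} d → Q x → InP (recover x d)
    recover-InP (yes (k , l)) x∈Q = Q-afterLeaf x∈Q l
    recover-InP (no ¬l)       x∈Q = ¬Leaf⇒InP ¬l

    recovery : PartialFunction
    recovery = record
      { dom        = Q
      ; apply      = λ x _ → recover x em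
      ; dom-resp-≗ = Q-resp-≗
      ; apply-cong = λ _ _ → recover-cong em em
      }

    recovery-learnable : IsLearnableWithBoundedMindChanges recovery
    recovery-learnable = learner , learner-computable , (λ x _ → limit x em) , 1 , λ x _ → changes x em
      where
      limit : ∀ x (d : Dec (∃ (Leaf x))) →
              ∃[ e ] Limit (λ n → learner (x ↾ n)) e ×
                     Σ (x ∈ dom (Φ e)) λ d′ → apply (Φ e) x d′ ≗ recover x d
      limit x (yes (k , l)) = shiftIndex , (k , λ n → learner-after l) ,
        (λ n → _ , ⊢shift l n) , λ _ → refl
      limit x (no ¬l) = identityIndex , (0 , λ n _ → learner-before (λ j _ → ¬Leaf⇒InP ¬l j)) ,
        (λ n → _ , ⊢identity x n) , λ _ → refl

      changes : ∀ x → Dec (∃ (Leaf x)) → HasAtMost 1 (MindChange learner x)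
      changes x (no ¬l) = [] , z≤n , λ n change → ⊥-elim (change
        (trans (learner-before (λ j _ → ¬Leaf⇒InP ¬l j)) (sym (learner-before (λ j _ → ¬Leaf⇒InP ¬l j)))))
      -- The guess can change only between the lengths `pred k` and `k`. For `k` equal to 0 it never
      -- changes, and the list is merely an upper bound.
      changes x (yes (k , l)) = pred k ∷ [] , s≤s z≤n , λ n change → here (at n change (<-cmp (suc n) k))
        where
        before : ∀ {n} → n < k → learner (x ↾ n) ≡ identityIndex
        before n<k = learner-before (λ j j≤n → proj₁ l j (≤-trans (s≤s j≤n) n<k))

        at : ∀ n → MindChange learner x n → Tri (suc n < k) (suc n ≡ k) (k < suc n) → n ≡ pred k
        at n change (tri< 1+n<k _ _) = ⊥-elim (change
          (trans (before 1+n<k) (sym (before (<⇒≤ 1+n<k)))))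
        at n change (tri≈ _ refl _)  = refl
        at n change (tri> _ _ k<1+n) = ⊥-elim (change
          (trans (learner-after l (<⇒≤ k<1+n)) (sym (learner-after l (s≤s⁻¹ k<1+n)))))

  -- Prefixing a proposed leaf to a sequence.

  -- q = ⟪ ⟪ k , r ⟫ , s ⟫ proposes the leaf nth r ↾ k, together with the
  -- resources s with which c is to be evaluated.
  cut fuel : ℕ → ℕ
  cut q  = left (left q)
  fuel q = right q

  stem : ℕ → Baire
  stem q = nth (right (left q))

  glue : ℕ → Baire → Baire
  glue q y i = caseℕ (cut q ∸ i) (y (i ∸ cut q)) (λ _ → stem q i)

  -- `glue` for partial oracles. The stem is known even when `τ` is empty, so `suc` marks its
  -- entries as defined.
  partialGlue : ℕ → ℕ → ℕ → ℕ
  partialGlue q τ i = caseℕ (cut q ∸ i) (nth τ (i ∸ cut q)) (λ _ → suc (stem q i))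

  leafGoodness : ℕ → ℕ
  leafGoodness q = sumBelow (pred ∘ stem q) (cut q) + firstDefect (stem q) (cut q)

  glue-below : ∀ q y i → i < cut q → stem q i ≡ glue q y i
  glue-below q y i i<k with cut q ∸ i | m<n⇒0<n∸m i<k
  ... | suc _ | _ = refl

  glue-above : ∀ q y i → y i ≡ glue q y (cut q + i)
  glue-above q y i rewrite m≤n⇒m∸n≡0 (m≤m+n (cut q) i) | m+n∸m≡n (cut q) i = refl

  -- A leaf depends only on the entries before it, so the cut remains a leaf after gluing; by
  -- uniqueness it is the only one, and `y` follows it.
  glue∈Q : ∀ q {y} → leafGoodness q ≡ 0 → Cantor y → InP y → Q (glue q y)
  glue∈Q q {y} good y∈2 y∈P = Q-intro binary after
    where
    leaf : Leaf (glue q y) (cut q)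
    leaf = Leaf-cong (glue-below q y)
      (firstDefect⇒Leaf (m+n≡0⇒n≡0 (sumBelow (pred ∘ stem q) (cut q)) good))

    after : ∀ {k} → Leaf (glue q y) k → InP (shift k (glue q y))
    after l with refl ← Leaf-unique leaf l = InP-resp-≗ (glue-above q y) y∈P

    binary : Cantor (glue q y)
    binary i with i <? cut q
    ... | yes i<k = subst (_< 2) (glue-below q y i i<k)
      (pred-zero (sumBelow-zero (pred ∘ stem q) (cut q) (m+n≡0⇒m≡0 _ good) i i<k))
    ... | no i≮k = subst (λ j → glue q y j < 2) (m+[n∸m]≡n (≮⇒≥ i≮k))
      (subst (_< 2) (glue-above q y (i ∸ cut q)) (y∈2 _))

  nth-↾-suc : ∀ f {i n v} → nth ⌜ f ↾ n ⌝ i ≡ suc v → f i ≡ suc v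
  nth-↾-suc f {i} {n} eq with i <? n
  ... | yes i<n = trans (sym (nth-↾ f i<n)) eq
  ... | no i≮n with () ← trans (sym (nth-↾-beyond f (≮⇒≥ i≮n))) eq

  partialGlue-ext : ∀ q {y τ} s → Ext y τ → Ext (glue q y) ⌜ partialGlue q τ ↾ s ⌝
  partialGlue-ext q {y} {τ} s ext i v eq =
    pointwise (cut q ∸ i) (nth-↾-suc (partialGlue q τ) {i} {s} eq)
    where
    pointwise : ∀ d → caseℕ d (nth τ (i ∸ cut q)) (λ _ → suc (stem q i)) ≡ suc v →
                caseℕ d (y (i ∸ cut q)) (λ _ → stem q i) ≡ v
    pointwise zero    = ext _ v
    pointwise (suc _) = suc-injective

  partialGlue-agrees : ∀ q {y τ N s} → N ≤ s → Agrees N y τ →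
                       Agrees N (glue q y) ⌜ partialGlue q τ ↾ s ⌝
  partialGlue-agrees q {y} {τ} N≤s agr i i<N =
    trans (nth-↾ (partialGlue q τ) (≤-trans i<N N≤s)) pointwise
    where
    pointwise : partialGlue q τ i ≡ suc (glue q y i)
    pointwise with cut q ∸ i
    ... | zero  = agr _ (≤-<-trans (m∸n≤m i (cut q)) i<N)
    ... | suc _ = refl

  -- There is no computable reduction of `P` to `Q`.

  module FixedPoint
    (em : ExcludedMiddle 0ℓ)
    (InP⊆Cantor : ∀ {x} → InP x → Cantor x)
    (noComputable : ∀ x → InP x → ¬ Computable x)
    (x₀ : Baire) (x₀∈P : InP x₀)
    (c : Code ⊤)
    (c-reduces : ∀ x → Q x → ∃[ y ] InP y × (∀ n → (λ _ → x) ⊢ c [ n ]⇓ y n))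
    where

    -- Results of `ev` and partial oracles both use 0 for undefined and `suc` for a value, so a
    -- table of results can serve as the next oracle.
    output : ℕ → ℕ → ℕ
    output w s = ⌜ ev c w s ↾ s ⌝

    through : ℕ → ℕ → ℕ → ℕ
    through q τ s = output ⌜ partialGlue q τ ↾ s ⌝ s

    output-ext : ∀ {x y w} → (∀ n → (λ _ → x) ⊢ c [ n ]⇓ y n) → ∀ s → Ext x w → Ext y (output w s)
    output-ext {w = w} x⊢y s ext i v eq =
      ⇓-deterministic (x⊢y i) (ev-sound ext c (nth-↾-suc (ev c w s) {i} {s} eq))

    -- The bound also includes `M`, since `s` is at the same time the length of the table.
    output-agrees : ∀ {x y} → (∀ n → (λ _ → x) ⊢ c [ n ]⇓ y n) →
                    ∀ M → ∃[ N ] (∀ s w → N ≤ s → Agrees N x w → Agrees M y (output w s))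
    output-agrees x⊢y M with eventuallyBelow (λ _ → completeness-mono c) M (λ i _ → ev-complete (x⊢y i))
    ... | N , h = N ⊔ M , λ s w N⊔M≤s agr i i<M →
      trans (nth-↾ (ev c w s) (≤-trans i<M (≤-trans (m≤n⊔m N M) N⊔M≤s)))
            (h i i<M s w (≤-trans (m≤m⊔n N M) N⊔M≤s) (Agrees-≤ {w = w} (m≤m⊔n N M) agr))

    -- The newest leaf heads the list `L` and is applied first, so the map of the oldest leaf is
    -- outermost.
    throughAll : ℕ → ℕ → ℕ → ℕ → ℕ
    throughAll L τ s = natrec τ (λ j v → through (nth L j) v s)

    -- `natrec` unfolds at the outermost map, whereas a new leaf enters innermost.
    throughAll-cons : ∀ q L τ s m → throughAll (suc ⟪ q , L ⟫) τ s (suc m) ≡ throughAll L (through q τ s) s m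
    throughAll-cons q L τ s zero    = cong (λ q → through q τ s) (nth-zero q L)
    throughAll-cons q L τ s (suc m) = cong₂ (λ q v → through q v s) (nth-suc q L m) (throughAll-cons q L τ s m)

    pass-good : ∀ q {y} → leafGoodness q ≡ 0 → InP y →
                ∃[ y′ ] InP y′ × (∀ n → (λ _ → glue q y) ⊢ c [ n ]⇓ y′ n)
    pass-good q {y} good y∈P = c-reduces (glue q y) (glue∈Q q good (InP⊆Cantor y∈P) y∈P)

    -- Continuity of the composite: the number of entries required is traced back through one map at
    -- a time.
    throughAll-agrees : ∀ L k → (∀ j → j < k → leafGoodness (nth L j) ≡ 0) → ∀ y → InP y →
      ∃[ y′ ] InP y′ × (∀ M → ∃[ N ] (∀ s τ → N ≤ s → Agrees N y τ → Agrees M y′ (throughAll L τ s k)))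
    throughAll-agrees L zero    _    y y∈P = y , y∈P , λ M → M , λ _ _ _ agr → agr
    throughAll-agrees L (suc k) good y y∈P
      with y₁ , y₁∈P , h₁ ← throughAll-agrees L k (λ j j<k → good j (m<n⇒m<1+n j<k)) y y∈P
      with y₂ , y₂∈P , r ← pass-good (nth L k) (good k ≤-refl) y₁∈P = y₂ , y₂∈P , bound
      where
      bound : ∀ M → ∃[ N ] (∀ s τ → N ≤ s → Agrees N y τ → Agrees M y₂ (throughAll L τ s (suc k)))
      bound M with N₂ , h₂ ← output-agrees r M
              with N₁ , h₁ ← h₁ N₂ = N₁ ⊔ N₂ , λ s τ N≤s agr →
        h₂ s _ (≤-trans (m≤n⊔m N₁ N₂) N≤s)
          (partialGlue-agrees (nth L k) (≤-trans (m≤n⊔m N₁ N₂) N≤s)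
            (h₁ s τ (≤-trans (m≤m⊔n N₁ N₂) N≤s) (Agrees-≤ {w = τ} (m≤m⊔n N₁ N₂) agr)))

    -- Otherwise x₀ ↾ u followed by zeros would be a computable element of P.
    leafBeyond : ∀ u → ∃[ k ] u ≤ k × Leaf (nth ⌜ x₀ ↾ u ⌝) k
    leafBeyond u with em {∃ (Leaf (nth ⌜ x₀ ↾ u ⌝))}
    ... | no ¬leaf = ⊥-elim (noComputable _ (¬Leaf⇒InP em ¬leaf) (nth-computable ⌜ x₀ ↾ u ⌝))
    ... | yes (k , leaf) with ≤-total u k
    ...   | inj₁ u≤k = k , u≤k , leaf
    ...   | inj₂ k≤u = ⊥-elim (InP⇒¬Leaf x₀∈P (Leaf-cong (λ i i<k → nth-↾ x₀ (≤-trans i<k k≤u)) leaf))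

    extensionTest : ℕ → ℕ → ℕ → ℕ
    extensionTest k L q =
      leafGoodness q + isZero (nth (throughAll (suc ⟪ q , L ⟫) 0 (fuel q) (suc k)) k)

    -- Since `x₀` lies in `Q`, the code `c` sends it to some `y` in `P`, and the older maps send `y`
    -- to `y′`. The entries of `y′` up to `k` use `N₁` entries of `y`, and these use `u` entries of
    -- `x₀`. A leaf extending `x₀ ↾ u` therefore fixes the value at `k`, whatever follows the leaf.
    extension-exists : ∀ k L → (∀ j → j < k → leafGoodness (nth L j) ≡ 0) →
                       ∃[ q ] extensionTest k L q ≡ 0
    extension-exists k L good
      with y , y∈P , x₀⊢y ← c-reduces x₀ (Q-intro (InP⊆Cantor x₀∈P) (⊥-elim ∘ InP⇒¬Leaf x₀∈P))
      with y′ , _ , h₁ ← throughAll-agrees L k good y y∈P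
      with N₁ , h₁ ← h₁ (suc k)
      with u , h₀ ← output-agrees x₀⊢y N₁
      with l , u≤l , leaf ← leafBeyond u = q , +-zero goodq (cong isZero value)
      where
      r = ⌜ x₀ ↾ u ⌝
      -- The same resources must suffice for the new map and for the older ones.
      s = N₁ ⊔ u
      q = ⟪ ⟪ l , r ⟫ , s ⟫

      cut≡ : cut q ≡ l
      cut≡ = trans (cong left (left-pair ⟪ l , r ⟫ s)) (left-pair l r)

      code≡ : right (left q) ≡ r
      code≡ = trans (cong right (left-pair ⟪ l , r ⟫ s)) (right-pair l r)

      binary : ∀ i → pred (nth r i) ≡ 0
      binary i with i <? u
      ... | yes i<u = trans (cong pred (nth-↾ x₀ i<u)) (zero-pred (InP⊆Cantor x₀∈P i))
      ... | no i≮u  = cong pred (nth-↾-beyond x₀ (≮⇒≥ i≮u))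

      goodq : leafGoodness q ≡ 0
      goodq rewrite cut≡ | code≡ = +-zero (zero-sumBelow _ l (λ i _ → binary i)) (Leaf⇒firstDefect {nth r} leaf)

      agrees₀ : Agrees u x₀ ⌜ partialGlue q 0 ↾ s ⌝
      agrees₀ i i<u = trans (nth-↾ (partialGlue q 0) (≤-trans i<u (m≤n⊔m N₁ u))) below
        where
        below : partialGlue q 0 i ≡ suc (x₀ i)
        below with cut q ∸ i | m<n⇒0<n∸m (subst (i <_) (sym cut≡) (≤-trans i<u u≤l))
        ... | suc _ | _ = cong suc (trans (cong (λ w → nth w i) code≡) (nth-↾ x₀ i<u))

      value : nth (throughAll (suc ⟪ q , L ⟫) 0 (fuel q) (suc k)) k ≡ suc (y′ k)
      value = trans
        (cong (λ s → nth (throughAll (suc ⟪ q , L ⟫) 0 s (suc k)) k) (right-pair ⟪ l , r ⟫ s))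
        (trans (cong (λ w → nth w k) (throughAll-cons q L 0 s k))
          (h₁ s (through q 0 s) (m≤m⊔n N₁ u) (h₀ s _ (m≤n⊔m N₁ u) agrees₀) k ≤-refl))

    -- The guard makes the search for an extension total.
    guardedTest : ℕ → ℕ → ℕ → ℕ
    guardedTest k L q =
      caseℕ (sumBelow (λ j → leafGoodness (nth L j)) k) (extensionTest k L q) (λ _ → 0)

    guardedTest-zero : ∀ k L → ∃[ q ] guardedTest k L q ≡ 0
    guardedTest-zero k L with sumBelow (λ j → leafGoodness (nth L j)) k in eq
    ... | zero  = extension-exists k L (sumBelow-zero _ k eq)
    ... | suc _ = 0 , refl

    module Search where
      open DefectPrograms {I = ⊤} (λ _ → 0) (λ _ → noOracle) public

      cutᵖ : ∀ {k} {f : Env k → ℕ} → Program k f → Program k (λ ρ → cut (f ρ))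
      cutᵖ F = leftᵖ (leftᵖ F)

      stemᵖ : ∀ {k} {f : Env k → ℕ} → Program k f → Program (suc k) (λ (i , ρ) → stem (f ρ) i)
      stemᵖ F = nthᵖ (rightᵖ (leftᵖ (weakenᵖ F))) hereᵖ

      leafGoodnessᵖ : ∀ {k} {f : Env k → ℕ} → Program k f → Program k (λ ρ → leafGoodness (f ρ))
      leafGoodnessᵖ F =
        sumBelowᵖ (predᵖ (stemᵖ F)) (cutᵖ F) +ᵖ firstDefectᵖ (stemᵖ F) (cutᵖ F)

      throughᵖ : ∀ {k} {f g h : Env k → ℕ} → Program k f → Program k g → Program k h →
                 Program k (λ ρ → through (f ρ) (g ρ) (h ρ))
      throughᵖ {k} {f} {g} F G H =
        ↾ᵖ (evᵖ (λ _ → 0) (λ _ → noOracle) c (weakenᵖ (↾ᵖ glued H)) (weakenᵖ H) hereᵖ) H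
        where
        glued : Program (suc k) (λ (i , ρ) → partialGlue (f ρ) (g ρ) i)
        glued = caseᵖ (cutᵖ (weakenᵖ F) ∸ᵖ hereᵖ)
          (nthᵖ (weakenᵖ G) (hereᵖ ∸ᵖ cutᵖ (weakenᵖ F)))
          (sucᵖ (weakenᵖ (stemᵖ F)))

      throughAllᵖ : ∀ {k} {f h n : Env k → ℕ} → Program k f → Program k h → Program k n →
                    Program k (λ ρ → throughAll (f ρ) 0 (h ρ) (n ρ))
      throughAllᵖ F H N = natrecᵖ (constᵖ 0)
        (throughᵖ (nthᵖ (weakenᵖ (weakenᵖ F)) hereᵖ) (weakenᵖ hereᵖ) (weakenᵖ (weakenᵖ H))) N

      guardedTestᵖ : Program 2 (λ (q , p , _) → guardedTest (left p) (right p) q)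
      guardedTestᵖ = caseᵖ (sumBelowᵖ (leafGoodnessᵖ (nthᵖ (rightᵖ (weakenᵖ (weakenᵖ hereᵖ))) hereᵖ))
                                      (leftᵖ (weakenᵖ hereᵖ)))
        (leafGoodnessᵖ hereᵖ +ᵖ
         isZeroᵖ (nthᵖ (throughAllᵖ (sucᵖ (pairᵖ hereᵖ (rightᵖ (weakenᵖ hereᵖ)))) (rightᵖ hereᵖ)
                                    (sucᵖ (leftᵖ (weakenᵖ hereᵖ))))
                       (leftᵖ (weakenᵖ hereᵖ))))
        (constᵖ 0)

      search : ∃[ m ] Program 1 m × (∀ (ρ@(p , _) : Env 1) → guardedTest (left p) (right p) (m ρ) ≡ 0)
      search = searchᵖ guardedTestᵖ (λ (p , _) → guardedTest-zero (left p) (right p))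

      opaque
        choose : ℕ → ℕ
        choose p = proj₁ search (p , tt)

        chooseᵖ : Program 1 (λ (p , _) → choose p)
        chooseᵖ = proj₁ (proj₂ search)

        choose-test : ∀ k L → guardedTest k L (choose ⟪ k , L ⟫) ≡ 0
        choose-test k L = subst₂ (λ k′ L′ → guardedTest k′ L′ (choose ⟪ k , L ⟫) ≡ 0)
          (left-pair k L) (right-pair k L) (proj₂ (proj₂ search) (⟪ k , L ⟫ , tt))

      leaves : ℕ → ℕ
      leaves = natrec 0 (λ k L → suc ⟪ choose ⟪ k , L ⟫ , L ⟫)

      newest : ℕ → ℕ
      newest k = choose ⟪ k , leaves k ⟫

      -- The innermost argument is the empty oracle 0, so nothing about a continuation is used;
      -- `pred` removes the mark of definedness.
      z : Baire
      z k = pred (nth (throughAll (leaves (suc k)) 0 (fuel (newest k)) (suc k)) k)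

      leavesᵖ : Program 1 (λ (n , _) → leaves n)
      leavesᵖ = natrecᵖ (constᵖ 0)
        (sucᵖ (pairᵖ (letᵖ (pairᵖ hereᵖ (weakenᵖ hereᵖ))
                           (weaken¹ᵖ (weaken¹ᵖ (weaken¹ᵖ chooseᵖ))))
                     (weakenᵖ hereᵖ)))
        hereᵖ

      z-computable : Computable z
      z-computable = closed-computable (predᵖ (nthᵖ
        (throughAllᵖ (letᵖ (sucᵖ hereᵖ) (weaken¹ᵖ leavesᵖ))
                     (rightᵖ (letᵖ (pairᵖ hereᵖ leavesᵖ) (weaken¹ᵖ chooseᵖ)))
                     (sucᵖ hereᵖ))
        hereᵖ))

    open Search using (z; z-computable; leaves; newest; choose-test)

    -- By mutual induction: the earlier leaves are good, so the guard at stage `k` is open, and the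
    -- test passed there includes the goodness of the newest leaf.
    leaves-good : ∀ k j → j < k → leafGoodness (nth (leaves k) j) ≡ 0
    newest-test : ∀ k → extensionTest k (leaves k) (newest k) ≡ 0
    newest-good : ∀ k → leafGoodness (newest k) ≡ 0

    leaves-good (suc k) zero    _   = trans (cong leafGoodness (nth-zero (newest k) (leaves k))) (newest-good k)
    leaves-good (suc k) (suc j) j<k =
      trans (cong leafGoodness (nth-suc (newest k) (leaves k) j)) (leaves-good k j (s≤s⁻¹ j<k))

    newest-test k = subst (λ t → caseℕ t (extensionTest k (leaves k) (newest k)) (λ _ → 0) ≡ 0)
      (zero-sumBelow _ k (leaves-good k)) (choose-test k (leaves k))

    newest-good k = m+n≡0⇒m≡0 _ (newest-test k)

    z-value : ∀ k → nth (throughAll (leaves (suc k)) 0 (fuel (newest k)) (suc k)) k ≡ suc (z k)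
    z-value k with _ , e ← isZero-zero (m+n≡0⇒n≡0 (leafGoodness (newest k)) (newest-test k)) =
      trans e (cong suc (sym (cong pred e)))

    -- The newest leaf acts innermost, so the induction replaces `y` by its image under that map and
    -- continues with the older leaves. This is why `y` ranges over all of `P`.
    z-approximated : ∀ n y → InP y → ∃[ y′ ] InP y′ ×
      (∀ τ s → Ext y τ → Ext y′ (throughAll (leaves n) τ s n)) × (∀ i → i < n → y′ i ≡ z i)
    z-approximated zero    y y∈P = y , y∈P , (λ _ _ ext → ext) , λ _ ()
    z-approximated (suc n) y y∈P
      with y₁ , y₁∈P , r ← pass-good (newest n) (newest-good n) y∈P
      with y′ , y′∈P , ext′ , agree ← z-approximated n y₁ y₁∈P = y′ , y′∈P , sound , agree′
      where
      sound : ∀ τ s → Ext y τ → Ext y′ (throughAll (leaves (suc n)) τ s (suc n))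
      sound τ s ext = subst (Ext y′) (sym (throughAll-cons (newest n) (leaves n) τ s n))
        (ext′ _ s (output-ext r s (partialGlue-ext (newest n) s ext)))

      agree′ : ∀ i → i < suc n → y′ i ≡ z i
      agree′ i i<1+n with m≤n⇒m<n∨m≡n (s≤s⁻¹ i<1+n)
      ... | inj₁ i<n  = agree i i<n
      -- The empty oracle is extended by every `y`, so the value found by the search is that of
      -- `y′`.
      ... | inj₂ refl = sound 0 (fuel (newest n)) Ext-nil n (z n) (z-value n)

    z∈P : InP z
    z∈P n with y′ , y′∈P , _ , agree ← z-approximated n x₀ x₀∈P =
      trans (cong defect (applyUpTo-cong n (λ i i<n → sym (agree i i<n)))) (y′∈P n)

    contradiction : ⊥
    contradiction = noComputable z z∈P z-computable

-- The comparison of `P` and `Q`.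

corollary31 : ExcludedMiddle 0ℓ →
    (P : Pred Baire 0ℓ) → P ⊆ Cantor → Π⁰₁ P → Special P →
    Σ (Pred Baire 0ℓ) λ Q → Q ⊆ Cantor × Π⁰₁ Q × Q <¹₁ P × Q ≡¹<ω P
corollary31 em P P⊆2 (R , R-computable , P⇔R) ((x₀ , x₀∈P) , special) =
  Q , Q⊆Cantor , (RQ , RQ-computable , λ x → mk⇔ id id) ,
  ((identity , (identityIndex , identity≃Φ) , (λ _ _ → tt) , P⊆Q) , P≰Q) ,
  (identity , identity-learnable , (λ _ _ → tt) , P⊆Q) ,
  recovery em , recovery-learnable em , (λ _ x∈Q → x∈Q) , λ x x∈Q → InP⇒P (recover-InP em em x∈Q)
  where
  open Concatenation R R-computable

  InP⇒P : ∀ {x} → InP x → x ∈ P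
  InP⇒P {x} h = Equivalence.from (P⇔R x) (λ n → defect⇒T (h n))

  P⇒InP : ∀ {x} → x ∈ P → InP x
  P⇒InP {x} x∈P n = T⇒defect (Equivalence.to (P⇔R x) x∈P n)

  P⊆Q : ∀ x → x ∈ P → Q x
  P⊆Q x x∈P = Q-intro (P⊆2 x∈P) (⊥-elim ∘ InP⇒¬Leaf (P⇒InP x∈P))

  identity : PartialFunction
  identity = record
    { dom        = λ _ → ⊤
    ; apply      = λ x _ → x
    ; dom-resp-≗ = λ _ _ → tt
    ; apply-cong = λ _ _ x≗y → x≗y
    }

  identity≃Φ : identity ≃ Φ identityIndex
  identity≃Φ = (λ x → mk⇔ (λ _ n → x n , ⊢identity x n) (λ _ → tt)) ,
    λ x _ d n → ⇓-deterministic (⊢identity x n) (proj₂ (d n))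

  identity-learnable : IsLearnableWithBoundedMindChanges identity
  identity-learnable = (λ _ → identityIndex) , (code (constᵖ identityIndex) , runs (constᵖ identityIndex)) ,
    (λ x _ → identityIndex , (0 , λ _ _ → refl) , (λ n → x n , ⊢identity x n) , λ _ → refl) ,
    0 , λ _ _ → [] , z≤n , λ _ change → ⊥-elim (change refl)
    where open StringPrograms

  P≰Q : ¬ (P ≤¹₁ Q)
  -- On `Q` the reduction agrees with `Φ e`, so the code with index `e` takes the part of `c`.
  P≰Q (Γ , (e , dom⇔ , Γ≗Φ) , Q⊆dom , Γ∈P) = FixedPoint.contradiction
    em (P⊆2 ∘ InP⇒P) (λ x → special x ∘ InP⇒P) x₀ (P⇒InP x₀∈P) (decode e)
    λ x x∈Q → let d  = Q⊆dom x x∈Q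
                  d′ = Equivalence.to (dom⇔ x) d
              in apply (Φ e) x d′ , InP-resp-≗ (Γ≗Φ x d d′) (P⇒InP (Γ∈P x x∈Q)) , λ n → proj₂ (d′ n)
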